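{- There exist positive constants $C$ and $n_0$ such that for every non-decreasing function $f:\mathbb{N}\to\mathbb{N}$ with $n\leqslant f(n)\leqslant R(K_n)$ for all $n\in\mathbb{N}$, there exists a sequence of connected graphs $(G_n)_{n\in\mathbb{N}}$ such that for all $n\geqslant n_0$, $|V(G_n)|=n$ and $$f(n)\leqslant R(G_n)\leqslant C f(n).$$
   Context: For a graph $G$, the (two-colour) Ramsey number $R(G)$ is the smallest integer $N$ such that every colouring of the edges of the complete graph $K_N$ with two colours contains a copy of $G$ all of whose edges have the same colour. $K_n$ denotes the complete graph on $n$ vertices. -}

module Defs where

open import Data.Bool.Base using (Bool; true; false; not)
import Data.Bool.Properties as Bool
open import Data.Empty using (⊥-elim)
open import Data.Fin.Base
  using (Fin; zero; suc; toℕ; cast; combine; quotient; remainder; finToFun; funToFin)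
import Data.Fin.Properties as Finₚ
open Finₚ using (_≟_)
open import Data.List.Base using (List; []; _∷_; length; lookup; filter; allFin)
open import Data.List.Membership.Propositional.Properties using (∈-lookup)
open import Data.List.Properties using (length-tabulate)
open import Data.List.Relation.Binary.Subset.Propositional using (_⊆_)
open import Data.List.Relation.Binary.Subset.Propositional.Properties
  using (All-resp-⊇; filter-⊆)
open import Data.List.Relation.Unary.All as All using (All; []; _∷_)
open import Data.List.Relation.Unary.All.Properties using (all-filter)
open import Data.List.Relation.Unary.AllPairs as AllPairs using (AllPairs; []; _∷_)
import Data.List.Relation.Unary.AllPairs.Properties as AllPairs
open import Data.List.Relation.Unary.Any using (here; there)
open import Data.List.Relation.Unary.Unique.Propositional using (Unique)
open import Data.List.Relation.Unary.Unique.Propositional.Properties using (allFin⁺)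
open import Data.Nat.Base using (ℕ; zero; suc; _+_; _*_; _^_; _≤_; _<_; NonZero)
open import Data.Nat.Induction using (<-rec)
open import Data.Nat.Properties
  using (≤-refl; ≤-trans; ≤-reflexive; <⇒≱; ≰⇒>; ≮⇒≥; _≤?_; m^n>0; anyUpTo?;
         +-suc; +-identityʳ; +-mono-≤; n<1+n; module ≤-Reasoning)
open import Data.Product.Base using (∃; ∃-syntax; _×_; _,_; proj₁; proj₂)
open import Data.Sum.Base using (_⊎_; inj₁; inj₂)
open import Function.Base using (_∘_)
open import Function.Definitions using (Injective)
open import Level using (0ℓ)
open import Relation.Binary.Construct.Closure.ReflexiveTransitive using (Star)
open import Relation.Binary.Core using (Rel)
open import Relation.Binary.PropositionalEquality
  using (_≡_; _≢_; _≗_; refl; sym; trans; cong; cong₂)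
open import Relation.Nullary using (Dec; yes; no)
open import Relation.Nullary.Decidable using (map′; _×-dec_; _→-dec_; dec-true; does)
open import Relation.Unary using (Decidable)

record Graph : Set where
  field
    order  : ℕ
    adj    : Fin order → Fin order → Bool
    symm   : ∀ u v → adj u v ≡ adj v u
    irrefl : ∀ v → adj v v ≡ false

  Vertex : Set
  Vertex = Fin order

  Adj : Rel Vertex 0ℓ
  Adj u v = adj u v ≡ true

open Graph public using (order)

complete : ℕ → Graph
complete n = record
  { order  = n
  ; adj    = λ u v → not (does (u ≟ v))
  ; symm   = λ u v → cong not (≟-comm u v)
  ; irrefl = λ v → cong not (dec-true (v ≟ v) refl)
  }
  where
  ≟-comm : ∀ {n} (u v : Fin n) → does (u ≟ v) ≡ does (v ≟ u)
  ≟-comm zero    zero    = refl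
  ≟-comm zero    (suc v) = refl
  ≟-comm (suc u) zero    = refl
  ≟-comm (suc u) (suc v) = ≟-comm u v

-- The graph without vertices does not count as connected.
Connected : Graph → Set
Connected G = NonZero (order G) × (∀ u v → Star Adj u v)
  where open Graph G

Colour : Set
Colour = Fin 2

-- A colouring of the edges of the complete graph on Fin N.  The values on the
-- diagonal carry no information: copies of a graph never look at them.
record Colouring (N : ℕ) : Set where
  field
    colour : Fin N → Fin N → Colour
    symm   : ∀ u v → colour u v ≡ colour v u

open Colouring public using (colour)

-- A copy of G in the complete graph on Fin N, not necessarily induced, all of
-- whose edges have colour c.
IsMonoCopy : (G : Graph) {N : ℕ} → (Fin N → Fin N → Colour) → Colour →
             (Graph.Vertex G → Fin N) → Set
IsMonoCopy G χ c φ = Injective _≡_ _≡_ φ × (∀ u v → Adj u v → χ (φ u) (φ v) ≡ c)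
  where open Graph G

HasMonoCopy : (G : Graph) {N : ℕ} → (Fin N → Fin N → Colour) → Set
HasMonoCopy G χ = ∃[ c ] ∃[ φ ] IsMonoCopy G χ c φ

Arrows : ℕ → Graph → Set
Arrows N G = (χ : Colouring N) → HasMonoCopy G (colour χ)

IsRamseyNumber : Graph → ℕ → Set
IsRamseyNumber G N = Arrows N G × (∀ M → Arrows M G → N ≤ M)

-- The rest proves Ramsey's theorem and the decidability of Arrows, so that the
-- least such N exists constructively and R is a function.

module Finiteness where

  anyFunction? : ∀ {m n p} {P : (Fin m → Fin n) → Set p} → Decidable P →
                 (∀ {f g} → f ≗ g → P f → P g) → Dec (∃ P)
  anyFunction? P? resp = map′
    (λ (i , p) → finToFun i , p)
    (λ (f , p) → funToFin f , resp (λ x → sym (Finₚ.finToFun-funToFin f x)) p)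
    (Finₚ.any? (λ i → P? (finToFun i)))

  injective? : ∀ {m n} → Decidable (λ (φ : Fin m → Fin n) → Injective _≡_ _≡_ φ)
  injective? φ = map′ (λ h {x} {y} → h x y) (λ h x y → h)
    (Finₚ.all? λ x → Finₚ.all? λ y → (φ x ≟ φ y) →-dec (x ≟ y))

  hasMonoCopy? : ∀ G {N} (χ : Fin N → Fin N → Colour) → Dec (HasMonoCopy G χ)
  hasMonoCopy? G χ = Finₚ.any? λ c → anyFunction?
    (λ φ → injective? φ ×-dec
           (Finₚ.all? λ u → Finₚ.all? λ v →
              (Graph.adj G u v Bool.≟ true) →-dec (χ (φ u) (φ v) ≟ c)))
    (λ f≗g (inj , mono) →
       (λ {x} {y} eq → inj (trans (f≗g x) (trans eq (sym (f≗g y))))) ,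
       (λ u v e → trans (cong₂ χ (sym (f≗g u)) (sym (f≗g v))) (mono u v e)))

  hasMonoCopy-resp : ∀ G {N} {χ χ′ : Fin N → Fin N → Colour} →
                     (∀ u v → χ u v ≡ χ′ u v) → HasMonoCopy G χ → HasMonoCopy G χ′
  hasMonoCopy-resp G χ≗χ′ (c , φ , inj , mono) =
    c , φ , inj , λ u v e → trans (sym (χ≗χ′ (φ u) (φ v))) (mono u v e)

  decode : ∀ {N} → Fin (2 ^ (N * N)) → Fin N → Fin N → Colour
  decode i u v = finToFun i (combine u v)

  encode : ∀ {N} → (Fin N → Fin N → Colour) → Fin (2 ^ (N * N))
  encode {N} χ = funToFin {N * N} (λ e → χ (quotient N e) (remainder {N} N e))

  decode-encode : ∀ {N} (χ : Fin N → Fin N → Colour) u v → decode (encode χ) u v ≡ χ u v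
  decode-encode {N} χ u v = trans
    (Finₚ.finToFun-funToFin (λ e → χ (quotient N e) (remainder {N} N e)) (combine u v))
    (cong (λ (x , y) → χ x y) (Finₚ.remQuot-combine u v))

  arrows? : ∀ G → Decidable (λ N → Arrows N G)
  arrows? G N = map′
    (λ h χ → hasMonoCopy-resp G (decode-encode (colour χ))
      (h (encode (colour χ)) λ u v →
        trans (decode-encode (colour χ) u v)
          (trans (Colouring.symm χ u v) (sym (decode-encode (colour χ) v u)))))
    (λ h i s → h (record { colour = decode i ; symm = s }))
    (Finₚ.all? {2 ^ (N * N)} λ i →
      (Finₚ.all? λ u → Finₚ.all? λ v → decode i u v ≟ decode i v u)
        →-dec hasMonoCopy? G (decode i))

  least : ∀ {p} {P : ℕ → Set p} → Decidable P → ∀ n → P n →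
          ∃[ m ] P m × (∀ k → P k → m ≤ k)
  least {P = P} P? = <-rec _ step
    where
    step : ∀ n → (∀ {m} → m < n → P m → ∃[ m ] P m × (∀ k → P k → m ≤ k)) →
           P n → ∃[ m ] P m × (∀ k → P k → m ≤ k)
    step n rec pn with anyUpTo? P? n
    ... | yes (m , m<n , pm) = rec m<n pm
    ... | no  none           = n , pn , λ k pk → ≮⇒≥ λ k<n → none (k , k<n , pk)

  red blue : Colour
  red  = zero
  blue = suc zero

  module _ {N : ℕ} (χ : Fin N → Fin N → Colour) where

    MonoPair : Colour → Rel (Fin N) 0ℓ
    MonoPair c u v = u ≢ v × χ u v ≡ c

    nbrs : Colour → Fin N → List (Fin N) → List (Fin N)
    nbrs c x = filter (λ y → χ x y ≟ c)

    length-nbrs : ∀ x ys → length (nbrs red x ys) + length (nbrs blue x ys) ≡ length ys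
    length-nbrs x [] = refl
    length-nbrs x (y ∷ ys) with χ x y
    ... | zero     = cong suc (length-nbrs x ys)
    ... | suc zero = trans (+-suc _ _) (cong suc (length-nbrs x ys))

    Clique : Colour → ℕ → List (Fin N) → Set
    Clique c a xs = ∃[ ys ] ys ⊆ xs × length ys ≡ a × AllPairs (MonoPair c) ys

    weaken : ∀ {c a xs ys} → xs ⊆ ys → Clique c a xs → Clique c a ys
    weaken xs⊆ys (zs , zs⊆xs , r) = zs , xs⊆ys ∘ zs⊆xs , r

    extend : ∀ {c a x xs} → All (x ≢_) xs → Clique c a (nbrs c x xs) → Clique c (suc a) (x ∷ xs)
    extend {c} {a} {x} {xs} x∉xs (ys , ys⊆ , refl , mono) =
      x ∷ ys ,
      (λ { (here eq) → here eq ; (there p) → there (filter-⊆ c≟ xs (ys⊆ p)) }) ,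
      refl ,
      All.zip (All-resp-⊇ (filter-⊆ c≟ xs ∘ ys⊆) x∉xs , All-resp-⊇ ys⊆ (all-filter c≟ xs)) ∷ mono
      where
      c≟ : Decidable (λ y → χ x y ≡ c)
      c≟ y = χ x y ≟ c

    cliques : ∀ a b xs → Unique xs → 2 ^ (a + b) ≤ length xs →
              Clique red a xs ⊎ Clique blue b xs
    cliques zero    b       xs _ _ = inj₁ ([] , (λ ()) , refl , [])
    cliques (suc a) zero    xs _ _ = inj₂ ([] , (λ ()) , refl , [])
    cliques (suc a) (suc b) [] _ l = ⊥-elim (<⇒≱ (m^n>0 2 (suc a + suc b)) l)
    cliques (suc a) (suc b) (x ∷ xs) (x∉xs ∷ xs!) l
      with 2 ^ (a + suc b) ≤? length (nbrs red x xs)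
    ... | yes p with cliques a (suc b) (nbrs red x xs) (AllPairs.filter⁺ _ xs!) p
    ...   | inj₁ r = inj₁ (extend x∉xs r)
    ...   | inj₂ s = inj₂ (weaken (there ∘ filter-⊆ _ xs) s)
    cliques (suc a) (suc b) (x ∷ xs) (x∉xs ∷ xs!) l | no ¬p
      with 2 ^ (a + suc b) ≤? length (nbrs blue x xs)
    ... | no ¬q = ⊥-elim (<⇒≱ small l)
      where
      open ≤-Reasoning
      r = length (nbrs red x xs)
      s = length (nbrs blue x xs)
      small : length (x ∷ xs) < 2 ^ (suc a + suc b)
      small = begin-strict
        suc (length xs)                   ≡⟨ cong suc (sym (length-nbrs x xs)) ⟩
        suc (r + s)                       <⟨ n<1+n _ ⟩
        suc (suc (r + s))                 ≡⟨ cong suc (sym (+-suc r s)) ⟩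
        suc r + suc s                     ≤⟨ +-mono-≤ (≰⇒> ¬p) (≰⇒> ¬q) ⟩
        2 ^ (a + suc b) + 2 ^ (a + suc b) ≡⟨ cong (2 ^ (a + suc b) +_) (sym (+-identityʳ _)) ⟩
        2 ^ (suc a + suc b)               ∎
    ... | yes q
      with cliques (suc a) b (nbrs blue x xs) (AllPairs.filter⁺ _ xs!)
             (≤-trans (≤-reflexive (cong (2 ^_) (sym (+-suc a b)))) q)
    ...   | inj₁ r = inj₁ (weaken (there ∘ filter-⊆ _ xs) r)
    ...   | inj₂ s = inj₂ (extend x∉xs s)

  lookup-pair : ∀ {A : Set} {S : Rel A 0ℓ} → (∀ {x y} → S x y → S y x) →
                ∀ {xs} → AllPairs S xs → ∀ i j → i ≢ j → S (lookup xs i) (lookup xs j)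
  lookup-pair sy (_  ∷ _)  zero    zero    i≢j = ⊥-elim (i≢j refl)
  lookup-pair sy (px ∷ _)  zero    (suc j) _   = All.lookup px (∈-lookup j)
  lookup-pair sy (px ∷ _)  (suc i) zero    _   = sy (All.lookup px (∈-lookup i))
  lookup-pair sy (_  ∷ ps) (suc i) (suc j) i≢j = lookup-pair sy ps i j (i≢j ∘ cong suc)

  clique⇒copy : ∀ G {N} (χ : Colouring N) {c} →
                ∃[ ys ] length ys ≡ order G × AllPairs (MonoPair (colour χ) c) ys →
                HasMonoCopy G (colour χ)
  clique⇒copy G χ {c} (ys , len , mono) = c , φ , inj , edge
    where
    open Graph G using (Adj; irrefl)
    φ : Fin (order G) → Fin _
    φ u = lookup ys (cast (sym len) u)

    pair : ∀ u v → u ≢ v → MonoPair (colour χ) c (φ u) (φ v)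
    pair u v u≢v = lookup-pair
      (λ {x} {y} (x≢y , e) → (x≢y ∘ sym) , trans (Colouring.symm χ y x) e)
      mono _ _ (λ eq → u≢v (Finₚ.toℕ-injective (trans (sym (Finₚ.toℕ-cast (sym len) u))
                 (trans (cong toℕ eq) (Finₚ.toℕ-cast (sym len) v)))))

    inj : Injective _≡_ _≡_ φ
    inj {u} {v} eq with u ≟ v
    ... | yes u≡v = u≡v
    ... | no  u≢v = ⊥-elim (proj₁ (pair u v u≢v) eq)

    edge : ∀ u v → Adj u v → colour χ (φ u) (φ v) ≡ c
    edge u v uv = proj₂ (pair u v λ { refl → true≢false (trans (sym uv) (irrefl u)) })
      where
      true≢false : true ≢ false
      true≢false ()

  arrows : ∀ G → Arrows (2 ^ (order G + order G)) G
  arrows G χ with cliques (colour χ) (order G) (order G) (allFin _) (allFin⁺ _)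
                    (≤-reflexive (sym (length-tabulate (λ i → i))))
  ... | inj₁ (ys , _ , r) = clique⇒copy G χ (ys , r)
  ... | inj₂ (ys , _ , r) = clique⇒copy G χ (ys , r)

abstract
  ramsey : ∀ G → ∃[ N ] IsRamseyNumber G N
  ramsey G = Finiteness.least (Finiteness.arrows? G) (2 ^ (order G + order G)) (Finiteness.arrows G)

R : Graph → ℕ
R G = proj₁ (ramsey G)

R-isRamseyNumber : ∀ G → IsRamseyNumber G (R G)
R-isRamseyNumber G = proj₂ (ramsey G)

{-# OPTIONS --safe #-}
-- Let the kite on n vertices be a clique on k of them, one of whose vertices is joined to
-- all others.  Its Ramsey number is at least R(K_k), exceeds (k − 1)(n − 1) by Chvátal's
-- colouring, and is O(R(K_k) + k n): a vertex with many neighbours in both colours can be the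
-- hub of a kite of either colour, and among the vertices with few neighbours in one colour a
-- clique of the other colour is found greedily.  The least k for which one of the two
-- lower bounds reaches f(n) therefore works as soon as R(K_{k+1}) = O(R(K_k)).
--
-- For the latter, suppose a colouring of C R(K_k) points has no monochromatic K_{k+1}.  Some
-- colour class A at a point has half of them; A contains no K_k of that colour, hence every
-- vertex of A has fewer than R(K_k) neighbours in A in the opposite colour.  So A is
-- sparse in the opposite colour, and since R(K_k) is exponential in k, the argument of Erdős
-- and Szemerédi applies: a clique T of the first colour with fewer than k points can be
-- enlarged, because many points of A see all but k/64 points of T in that colour,
-- exponentially many of these miss the same points of T, and among those there is a clique
-- that more than makes up for the points missed.
module Submission where

open import Defs
open Finiteness
open import Algebra.Properties.CommutativeSemigroup using (x∙yz≈y∙xz)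
open import Data.Bool.Base using (true; not)
open import Data.Empty using (⊥-elim)
open import Data.Fin.Base
  using (Fin; zero; suc; toℕ; inject≤; opposite; combine; quotient; remainder; finToFun; funToFin)
import Data.Fin.Properties as Finₚ
open import Data.List.Base
  using (List; []; _∷_; _++_; length; lookup; filter; allFin; map; tabulate; take)
open import Data.List.Membership.Propositional using (_∈_; find)
open import Data.List.Membership.Propositional.Properties
  using (∈-lookup; ∈-filter⁺; ∈-filter⁻; ∈-tabulate⁻; ∈-map⁺; ∈-map⁻; ∈-++⁺ˡ; ∈-++⁺ʳ; ∈-++⁻; ∈-allFin)
open import Data.List.Properties
  using (length-tabulate; length-map; length-++; length-take; length-filter;
         filter-accept; filter-reject; filter-all; map-++; tabulate-cong)
open import Data.List.Relation.Binary.Subset.Propositional using (_⊆_)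
open import Data.List.Relation.Binary.Subset.Propositional.Properties
  using (All-resp-⊇; filter-⊆; ∷⁺ʳ)
open import Data.List.Relation.Unary.All as All using (All; []; _∷_)
import Data.List.Relation.Unary.All.Properties as All
open import Data.List.Relation.Unary.AllPairs as AllPairs using (AllPairs; []; _∷_)
import Data.List.Relation.Unary.AllPairs.Properties as AllPairs
open import Data.List.Relation.Unary.Any as Any using (here; there)
import Data.List.Relation.Unary.Unique.DecPropositional as Unique
open import Data.List.Relation.Unary.Unique.Propositional using (Unique)
import Data.List.Relation.Unary.Unique.Propositional.Properties as Unique
open import Data.Maybe.Base using (Maybe; just; nothing)
open import Data.Maybe.Properties using (just-injective)
open import Data.Nat.Base
open import Data.Nat.DivMod using (m≡m%n+[m/n]*n; m%n<n; m/n*n≤m)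
open import Data.Nat.ListAction using (sum)
open import Data.Nat.ListAction.Properties using (sum-++)
open import Data.Nat.Properties hiding (_≟_)
open import Data.Nat.Tactic.RingSolver using (solve-∀)
open import Data.Product.Base as Product using (Σ-syntax; ∃-syntax; _×_; _,_; proj₁; proj₂)
open import Data.Sum.Base as Sum using (_⊎_; inj₁; inj₂)
open import Data.Unit.Base using (tt)
open import Data.Vec.Base as Vec using (Vec; []; _∷_; _[_]≔_; replicate)
open import Data.Vec.Properties using (lookup-replicate; lookup∘updateAt; lookup∘updateAt′)
open import Function.Base using (_∘_; id)
open import Function.Bundles using (mk⇔)
open import Function.Definitions using (Injective)
open import Relation.Binary.Construct.Closure.ReflexiveTransitive using (Star; ε; _◅_)
open import Relation.Binary.Core using (_Preserves_⟶_)
open import Relation.Binary.PropositionalEquality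
open import Relation.Nullary using (Dec; yes; no; ¬_; ¬?; does)
open import Relation.Nullary.Decidable
  using (_×-dec_; _⊎-dec_; decidable-stable; dec-true; dec-false; does-⇔)
open import Relation.Unary using (Pred; Decidable)

-- Ramsey numbers and counting in lists

R-least : ∀ G {N} → Arrows N G → R G ≤ N
R-least G = proj₂ (R-isRamseyNumber G) _

R-arrows : ∀ G → Arrows (R G) G
R-arrows G = proj₁ (R-isRamseyNumber G)

distinct-adjacent : ∀ {k} {i j : Fin k} → i ≢ j → Graph.Adj (complete k) i j
distinct-adjacent i≢j = cong not (dec-false (_ Finₚ.≟ _) i≢j)

-- If both alternatives fail, a + b is at least c + d + 2. In `ramsey-ball` the slack of one absorbs
-- the vertex whose two neighbourhoods are compared.
+-≤-split : ∀ {a b c d} → a + b ≤ suc (c + d) → a ≤ c ⊎ b ≤ d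
+-≤-split {a} {b} {c} {d} le with a ≤? c | b ≤? d
... | yes p | _     = inj₁ p
... | no  _ | yes q = inj₂ q
... | no ¬p | no ¬q = ⊥-elim (<⇒≱ (≤-trans (s≤s (≤-reflexive (sym (+-suc c d)))) (+-mono-≤ (≰⇒> ¬p) (≰⇒> ¬q))) le)

module _ {A : Set} {p q} {P : Pred A p} {Q : Pred A q} (P? : Decidable P) (Q? : Decidable Q) where

  length-filter-cover : ∀ {xs} → All (λ x → P x ⊎ Q x) xs →
                        length xs ≤ length (filter P? xs) + length (filter Q? xs)
  length-filter-cover [] = z≤n
  length-filter-cover {x ∷ xs} (px ∷ pxs) with P? x | Q? x | length-filter-cover pxs
  ... | yes _ | yes _ | le = s≤s (≤-trans le (+-monoʳ-≤ _ (n≤1+n _)))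
  ... | yes _ | no  _ | le = s≤s le
  ... | no  _ | yes _ | le = ≤-trans (s≤s le) (≤-reflexive (sym (+-suc _ _)))
  ... | no ¬p | no ¬q | le = ⊥-elim (Sum.[ ¬p , ¬q ] px)

module _ {A : Set} {p} {P : Pred A p} (P? : Decidable P) where

  length-filter-split : ∀ xs → length xs ≤ length (filter P? xs) + length (filter (¬? ∘ P?) xs)
  length-filter-split xs = length-filter-cover P? (¬? ∘ P?) (All.universal dichotomy xs)
    where
    dichotomy : ∀ x → P x ⊎ ¬ P x
    dichotomy x with P? x
    ... | yes px = inj₁ px
    ... | no ¬px = inj₂ ¬px

  filter-∷≤ : ∀ x xs → length (filter P? xs) ≤ length (filter P? (x ∷ xs))
  filter-∷≤ x xs with P? x
  ... | yes _ = n≤1+n _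
  ... | no  _ = ≤-refl

module _ {A B : Set} {r} {R : A → B → Set r} (R? : ∀ x y → Dec (R x y)) where

  sum-length-filter : List A → List B → ℕ
  sum-length-filter xs ys = sum (map (λ x → length (filter (R? x) ys)) xs)

  -- Double counting of related pairs: the sum runs over rows, and this splits off the column of y.
  sum-length-filter-∷ : ∀ xs y ys → sum-length-filter xs (y ∷ ys) ≡
                        length (filter (λ x → R? x y) xs) + sum-length-filter xs ys
  sum-length-filter-∷ []       y ys = refl
  sum-length-filter-∷ (x ∷ xs) y ys with R? x y | sum-length-filter-∷ xs y ys
  ... | yes _ | eq rewrite eq = cong suc
    (x∙yz≈y∙xz +-commutativeSemigroup (length (filter (R? x) ys)) (length (filter (λ z → R? z y) xs)) _)
  ... | no  _ | eq rewrite eq =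
    x∙yz≈y∙xz +-commutativeSemigroup (length (filter (R? x) ys)) (length (filter (λ z → R? z y) xs)) _

  -- Every y related to at least s of the `xs` accounts for at least s of the related pairs.
  markov : ∀ s xs ys →
           s * length (filter (λ y → s ≤? length (filter (λ x → R? x y) xs)) ys) ≤ sum-length-filter xs ys
  markov s xs [] = ≤-trans (≤-reflexive (*-zeroʳ s)) z≤n
  markov s xs (y ∷ ys) rewrite sum-length-filter-∷ xs y ys = go (s ≤? length (filter (λ x → R? x y) xs))
    where
    heavy? : Decidable (λ y → s ≤ length (filter (λ x → R? x y) xs))
    heavy? y = s ≤? length (filter (λ x → R? x y) xs)

    go : Dec (s ≤ length (filter (λ x → R? x y) xs)) →
         s * length (filter heavy? (y ∷ ys)) ≤ length (filter (λ x → R? x y) xs) + sum-length-filter xs ys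
    go (yes le) rewrite filter-accept heavy? {xs = ys} le =
      ≤-trans (≤-reflexive (*-suc s _)) (+-mono-≤ le (markov s xs ys))
    go (no ¬le) rewrite filter-reject heavy? {xs = ys} ¬le = ≤-trans (markov s xs ys) (m≤n+m _ _)

sum-map-≤ : ∀ {A : Set} (g : A → ℕ) {b xs} → All (λ x → g x ≤ b) xs → sum (map g xs) ≤ length xs * b
sum-map-≤ g []         = z≤n
sum-map-≤ g (le ∷ les) = +-mono-≤ le (sum-map-≤ g les)

take-⊆ : ∀ {A : Set} n (xs : List A) → take n xs ⊆ xs
take-⊆ (suc n) (x ∷ xs) (here eq) = here eq
take-⊆ (suc n) (x ∷ xs) (there p) = there (take-⊆ n xs p)

module _ {N : ℕ} where

  delete : Fin N → List (Fin N) → List (Fin N)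
  delete u = filter (λ x → ¬? (u Finₚ.≟ x))

  length-delete : ∀ u {xs} → Unique xs → length xs ≤ suc (length (delete u xs))
  length-delete u [] = z≤n
  length-delete u {x ∷ xs} (x∉xs ∷ xs!) with u Finₚ.≟ x
  ... | yes refl = s≤s (≤-reflexive (cong length (sym (filter-all (λ y → ¬? (u Finₚ.≟ y)) x∉xs))))
  ... | no  _    = s≤s (length-delete u xs!)

-- ball t j is the number of subsets of size at most j of a t-element set.
ball : ℕ → ℕ → ℕ
ball zero    j       = 1
ball (suc t) zero    = ball t zero
ball (suc t) (suc j) = ball t (suc j) + ball t j

ball-pos : ∀ t j → 0 < ball t j
ball-pos zero    j       = s≤s z≤n
ball-pos (suc t) zero    = ball-pos t zero
ball-pos (suc t) (suc j) = ≤-trans (ball-pos t (suc j)) (m≤m+n _ _)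

-- Enlarging cliques in a two-colouring

colour-dichotomy : ∀ (c d : Colour) → d ≡ c ⊎ d ≡ opposite c
colour-dichotomy zero       zero       = inj₁ refl
colour-dichotomy zero       (suc zero) = inj₂ refl
colour-dichotomy (suc zero) zero       = inj₂ refl
colour-dichotomy (suc zero) (suc zero) = inj₁ refl

module Cliques {N : ℕ} (χ : Colouring N) where

  -- Distinctness is built in, so a vertex always counts among its own non-neighbours, in either
  -- colour.
  E : Colour → Fin N → Fin N → Set
  E = MonoPair (colour χ)

  E? : ∀ c u v → Dec (E c u v)
  E? c u v = ¬? (u Finₚ.≟ v) ×-dec (colour χ u v Finₚ.≟ c)

  E-sym : ∀ {c u v} → E c u v → E c v u
  E-sym {u = u} {v} (u≢v , eq) = (u≢v ∘ sym) , trans (Colouring.symm χ v u) eq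

  E-cover : ∀ c {u v} → u ≢ v → E c u v ⊎ E (opposite c) u v
  E-cover c {u} {v} u≢v = Sum.map (u≢v ,_) (u≢v ,_) (colour-dichotomy c (colour χ u v))

  HasClique : Colour → ℕ → List (Fin N) → Set
  HasClique = Clique (colour χ)

  cons : ∀ {c a x xs zs} → x ∈ zs → xs ⊆ zs → HasClique c a (filter (E? c x) xs) → HasClique c (suc a) zs
  cons {c} {x = x} {xs} x∈zs xs⊆zs (ys , ys⊆ , refl , mono) =
    x ∷ ys ,
    (λ { (here refl) → x∈zs ; (there p) → xs⊆zs (filter-⊆ (E? c x) xs (ys⊆ p)) }) ,
    refl ,
    All-resp-⊇ ys⊆ (All.all-filter (E? c x) xs) ∷ mono

  widen : ∀ {c a xs zs} → xs ⊆ zs → HasClique c a xs → HasClique c a zs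
  widen = weaken (colour χ)

  shrink : ∀ {c a b xs} → a ≤ b → HasClique c b xs → HasClique c a xs
  shrink {a = a} a≤b (ys , ys⊆ , refl , mono) =
    take a ys , ys⊆ ∘ take-⊆ a ys , trans (length-take a ys) (m≤n⇒m⊓n≡m a≤b) , AllPairs.take⁺ a mono

  join : ∀ {c b xs ys zs} → xs ⊆ zs → ys ⊆ zs → All (λ x → All (E c x) ys) xs →
         AllPairs (E c) xs → HasClique c b ys → HasClique c (length xs + b) zs
  join {xs = xs} xs⊆ ys⊆ joined mono (qs , qs⊆ , refl , mono′) =
    xs ++ qs , Sum.[ xs⊆ , ys⊆ ∘ qs⊆ ] ∘ ∈-++⁻ xs , length-++ xs ,
    AllPairs.++⁺ mono mono′ (All.map (All-resp-⊇ qs⊆) joined)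

  -- The Erdős-Szekeres argument. `ball (a + b) a` exceeds the binomial coefficient but obeys the
  -- same Pascal recursion, and the same function counts the classes in `common-neighbours`.
  ramsey-ball : ∀ c a b {xs} → Unique xs → ball (a + b) a ≤ length xs → HasClique c a xs ⊎ HasClique (opposite c) b xs
  ramsey-ball c zero    b       _ _ = inj₁ ([] , (λ ()) , refl , [])
  ramsey-ball c (suc a) zero    _ _ = inj₂ ([] , (λ ()) , refl , [])
  ramsey-ball c (suc a) (suc b) {[]} _ le = ⊥-elim (<⇒≱ (ball-pos (suc a + suc b) (suc a)) le)
  ramsey-ball c (suc a) (suc b) {x ∷ xs} (x∉xs ∷ xs!) le
    with +-≤-split {a = ball (a + suc b) a} (begin
           ball (a + suc b) a + ball (a + suc b) (suc a) ≡⟨ +-comm (ball (a + suc b) a) _ ⟩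
           ball (suc a + suc b) (suc a)                  ≤⟨ le ⟩
           suc (length xs)
             ≤⟨ s≤s (length-filter-cover (E? c x) (E? (opposite c) x) (All.map (E-cover c) x∉xs)) ⟩
           suc (length (filter (E? c x) xs) + length (filter (E? (opposite c) x) xs)) ∎)
    where open ≤-Reasoning
  ... | inj₁ p = Sum.map (cons (here refl) there) (widen (there ∘ filter-⊆ (E? c x) xs))
                   (ramsey-ball c a (suc b) (AllPairs.filter⁺ (E? c x) xs!) p)
  ... | inj₂ p = Sum.map (widen (there ∘ filter-⊆ (E? (opposite c) x) xs)) (cons (here refl) there)
                   (ramsey-ball c (suc a) b (AllPairs.filter⁺ (E? (opposite c) x) xs!)
                     (subst (λ t → ball t (suc a) ≤ length (filter (E? (opposite c) x) xs)) (+-suc a b) p))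

  deficiency : Colour → List (Fin N) → Fin N → ℕ
  deficiency c T b = length (filter (λ x → ¬? (E? c x b)) T)

  deficiency-∷ : ∀ c T {x b} → ¬ E c x b → deficiency c (x ∷ T) b ≡ suc (deficiency c T b)
  deficiency-∷ c T {b = b} ¬e = cong length (filter-accept (λ y → ¬? (E? c y b)) {xs = T} ¬e)

  -- Classify the points of B by the set of vertices of T to which they are not joined
  -- in colour c; there are at most ball (length T) j classes.
  common-neighbours : ∀ c j q T {B} → Unique B → AllPairs (E c) T →
    All (λ b → deficiency c T b ≤ j) B → ball (length T) j * q ≤ length B →
    ∃[ T′ ] ∃[ B′ ] T′ ⊆ T × AllPairs (E c) T′ × length T ≤ length T′ + j ×
      B′ ⊆ B × Unique B′ × q ≤ length B′ × All (λ x → All (E c x) B′) T′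
  common-neighbours c j q [] {B} B! _ _ le =
    [] , B , id , [] , z≤n , id , B! , subst (_≤ _) (+-identityʳ q) le , []
  common-neighbours c zero q (x ∷ T) {B} B! (Ex ∷ ET) def le
    with common-neighbours c zero q T B! ET (All.map (λ {b} → ≤-trans (filter-∷≤ (λ y → ¬? (E? c y b)) x T)) def) le
  ... | T′ , B′ , T′⊆ , ET′ , len , B′⊆ , B′! , q≤ , joined =
    x ∷ T′ , B′ , ∷⁺ʳ x T′⊆ , All-resp-⊇ T′⊆ Ex ∷ ET′ , s≤s len , B′⊆ , B′! , q≤ ,
    All-resp-⊇ B′⊆ (All.map adjacent def) ∷ joined
    where
    adjacent : ∀ {b} → deficiency c (x ∷ T) b ≤ 0 → E c x b
    adjacent {b} d = decidable-stable (E? c x b) λ ¬e → n≮0 (subst (_≤ 0) (deficiency-∷ c T ¬e) d)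
  common-neighbours c (suc j) q (x ∷ T) {B} B! (Ex ∷ ET) def le
    -- The split follows the recursion of `ball`: points joined to x keep x in the clique and the
    -- budget suc j, the others drop x and spend one unit of the budget.
    with +-≤-split {a = ball (length T) (suc j) * q} (begin
           ball (length T) (suc j) * q + ball (length T) j * q
             ≡⟨ *-distribʳ-+ q (ball (length T) (suc j)) _ ⟨
           ball (suc (length T)) (suc j) * q ≤⟨ le ⟩
           length B                          ≤⟨ length-filter-split (E? c x) B ⟩
           length (filter (E? c x) B) + length (filter (¬? ∘ E? c x) B) ≤⟨ n≤1+n _ ⟩
           suc (length (filter (E? c x) B) + length (filter (¬? ∘ E? c x) B)) ∎)
    where open ≤-Reasoning
  ... | inj₁ p
    with common-neighbours c (suc j) q T (AllPairs.filter⁺ (E? c x) B!) ET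
           (All.filter⁺ (E? c x) (All.map (λ {b} → ≤-trans (filter-∷≤ (λ y → ¬? (E? c y b)) x T)) def)) p
  ...   | T′ , B′ , T′⊆ , ET′ , len , B′⊆ , B′! , q≤ , joined =
    x ∷ T′ , B′ , ∷⁺ʳ x T′⊆ , All-resp-⊇ T′⊆ Ex ∷ ET′ , s≤s len , filter-⊆ (E? c x) B ∘ B′⊆ , B′! , q≤ ,
    All-resp-⊇ B′⊆ (All.all-filter (E? c x) B) ∷ joined
  common-neighbours c (suc j) q (x ∷ T) {B} B! (Ex ∷ ET) def le | inj₂ p
    with common-neighbours c j q T (AllPairs.filter⁺ (¬? ∘ E? c x) B!) ET
           (All.zipWith (λ {b} (d , ¬e) → s≤s⁻¹ (subst (_≤ suc j) (deficiency-∷ c T ¬e) d))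
             (All.filter⁺ (¬? ∘ E? c x) def , All.all-filter (¬? ∘ E? c x) B)) p
  ... | T′ , B′ , T′⊆ , ET′ , len , B′⊆ , B′! , q≤ , joined =
    T′ , B′ , there ∘ T′⊆ , ET′ , ≤-trans (s≤s len) (≤-reflexive (sym (+-suc _ _))) ,
    filter-⊆ (¬? ∘ E? c x) B ∘ B′⊆ , B′! , q≤ , joined

  -- An exchange. By `markov` at most t D / (m + 1) points of A miss more than m vertices of T. The
  -- remaining points include a set B′ fully joined to all but at most m vertices of T, large enough
  -- that `ramsey-ball` finds m + 1 vertices of colour c in it: at most m are lost and m + 1 are
  -- gained.
  enlarge : ∀ c t m b D {A} → Unique A → All (λ x → length (filter (¬? ∘ E? c x) A) ≤ D) A →
            t * D + suc m * (ball t m * ball (suc m + b) (suc m)) ≤ suc m * length A →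
            HasClique c t A → HasClique c (suc t) A ⊎ HasClique (opposite c) b A
  enlarge c t m b D {A} A! sparse le (T , T⊆ , refl , ET)
    with common-neighbours c m (ball (suc m + b) (suc m)) T
           (AllPairs.filter⁺ (¬? ∘ heavy?) A!) ET
           (All.map (s≤s⁻¹ ∘ ≰⇒>) (All.all-filter (¬? ∘ heavy?) A))
           (*-cancelˡ-≤ (suc m) (+-cancelˡ-≤ (t * D) _ _ (≤-trans le light)))
    where
    heavy? : Decidable (λ b → suc m ≤ deficiency c T b)
    heavy? b = suc m ≤? deficiency c T b
    open ≤-Reasoning
    light : suc m * length A ≤ t * D + suc m * length (filter (¬? ∘ heavy?) A)
    light = begin
      suc m * length A ≤⟨ *-monoʳ-≤ (suc m) (length-filter-split heavy? A) ⟩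
      suc m * (length (filter heavy? A) + length (filter (¬? ∘ heavy?) A))
        ≡⟨ *-distribˡ-+ (suc m) (length (filter heavy? A)) _ ⟩
      suc m * length (filter heavy? A) + suc m * length (filter (¬? ∘ heavy?) A)
        ≤⟨ +-monoˡ-≤ _ (≤-trans (markov (λ x b → ¬? (E? c x b)) (suc m) T A)
             (sum-map-≤ (λ x → length (filter (¬? ∘ E? c x) A)) (All-resp-⊇ T⊆ sparse))) ⟩
      t * D + suc m * length (filter (¬? ∘ heavy?) A) ∎
  ... | T′ , B′ , T′⊆ , ET′ , len , B′⊆ , B′! , q≤ , joined =
    Sum.map (λ clique → shrink (≤-trans (s≤s len) (≤-reflexive (sym (+-suc _ m))))
                          (join (T⊆ ∘ T′⊆) (filter-⊆ _ A ∘ B′⊆) joined ET′ clique))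
            (widen (filter-⊆ _ A ∘ B′⊆))
            (ramsey-ball c (suc m) b B′! q≤)

-- Exponential estimates for `ball`

ball-monoˡ : ∀ j {t u} → t ≤ u → ball t j ≤ ball u j
ball-monoˡ j {u = u} z≤n       = ball-pos u j
ball-monoˡ zero      (s≤s t≤u) = ball-monoˡ zero t≤u
ball-monoˡ (suc j)   (s≤s t≤u) = +-mono-≤ (ball-monoˡ (suc j) t≤u) (ball-monoˡ j t≤u)

^-distribʳ-* : ∀ n a b → (a * b) ^ n ≡ a ^ n * b ^ n
^-distribʳ-* zero    a b = refl
^-distribʳ-* (suc n) a b = trans (cong (a * b *_) (^-distribʳ-* n a b)) ([m*n]*[o*p]≡[m*o]*[n*p] a b _ _)

-- The entropy bound Σ_{i≤j} C(t,i) ≤ x^j (1 + 1/x)^t at x = 32, cleared of denominators.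
ball-entropy : ∀ t j → ball t j * 32 ^ t ≤ 32 ^ j * 33 ^ t
ball-entropy zero    j       = *-monoˡ-≤ 1 (m^n>0 32 j)
ball-entropy (suc t) zero    = begin
  ball t 0 * (32 * 32 ^ t) ≡⟨ lemma (ball t 0) (32 ^ t) ⟩
  32 * (ball t 0 * 32 ^ t) ≤⟨ *-mono-≤ (n≤1+n 32) (ball-entropy t zero) ⟩
  33 * (1 * 33 ^ t)        ≡⟨ lemma′ (33 ^ t) ⟩
  1 * (33 * 33 ^ t)        ∎
  where
  open ≤-Reasoning
  lemma : ∀ b p → b * (32 * p) ≡ 32 * (b * p)
  lemma = solve-∀
  lemma′ : ∀ p → 33 * (1 * p) ≡ 1 * (33 * p)
  lemma′ = solve-∀
ball-entropy (suc t) (suc j) = begin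
  (ball t (suc j) + ball t j) * (32 * 32 ^ t)                 ≡⟨ lemma (ball t (suc j)) (ball t j) (32 ^ t) ⟩
  32 * (ball t (suc j) * 32 ^ t) + 32 * (ball t j * 32 ^ t)
    ≤⟨ +-mono-≤ (*-monoʳ-≤ 32 (ball-entropy t (suc j))) (*-monoʳ-≤ 32 (ball-entropy t j)) ⟩
  32 * (32 ^ suc j * 33 ^ t) + 32 * (32 ^ j * 33 ^ t)         ≡⟨ lemma′ (32 ^ j) (33 ^ t) ⟩
  32 ^ suc j * 33 ^ suc t                                     ∎
  where
  open ≤-Reasoning
  lemma : ∀ a b p → (a + b) * (32 * p) ≡ 32 * (a * p) + 32 * (b * p)
  lemma = solve-∀
  lemma′ : ∀ p q → 32 * (32 * p * q) + 32 * (p * q) ≡ 32 * p * (33 * q)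
  lemma′ = solve-∀

ball-exponential : ∀ n j → ball (32 * n) j ≤ 32 ^ j * 4 ^ n
ball-exponential n j = *-cancelʳ-≤ _ _ (32 ^ (32 * n)) {{m^n≢0 32 (32 * n)}} (begin
  ball (32 * n) j * 32 ^ (32 * n)   ≤⟨ ball-entropy (32 * n) j ⟩
  32 ^ j * 33 ^ (32 * n)            ≡⟨ cong (32 ^ j *_) (^-*-assoc 33 32 n) ⟨
  -- The ratio (1 + 1/32)^32 is below e; the integer bound 4 is checked by evaluation and keeps the
  -- estimate a power of two.
  32 ^ j * (33 ^ 32) ^ n            ≤⟨ *-monoʳ-≤ (32 ^ j) (^-monoˡ-≤ n (≤ᵇ⇒≤ (33 ^ 32) (4 * 32 ^ 32) tt)) ⟩
  32 ^ j * (4 * 32 ^ 32) ^ n        ≡⟨ cong (32 ^ j *_) (^-distribʳ-* n 4 (32 ^ 32)) ⟩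
  32 ^ j * (4 ^ n * (32 ^ 32) ^ n)  ≡⟨ cong (λ p → 32 ^ j * (4 ^ n * p)) (^-*-assoc 32 32 n) ⟩
  32 ^ j * (4 ^ n * 32 ^ (32 * n))  ≡⟨ *-assoc (32 ^ j) (4 ^ n) _ ⟨
  32 ^ j * 4 ^ n * 32 ^ (32 * n)    ∎)
  where open ≤-Reasoning

ball-power : ∀ n j → ball (32 * n) j ≤ 2 ^ (5 * j + 2 * n)
ball-power n j = begin
  ball (32 * n) j           ≤⟨ ball-exponential n j ⟩
  32 ^ j * 4 ^ n            ≡⟨ cong₂ _*_ (^-*-assoc 2 5 j) (^-*-assoc 2 2 n) ⟩
  2 ^ (5 * j) * 2 ^ (2 * n) ≡⟨ ^-distribˡ-+-* 2 (5 * j) (2 * n) ⟨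
  2 ^ (5 * j + 2 * n)       ∎
  where open ≤-Reasoning

-- A literal 2 ^ 15 in place of 2 ^ c would be unfolded during conversion checking.
ball-product : ∀ c m k → 15 ≤ c → k ≤ 64 * suc m →
               ball k m * ball (suc m + suc k) (suc m) ≤ 2 ^ c * 2 ^ (32 * m)
ball-product c m k 15≤c k≤ = begin
  ball k m * ball (suc m + suc k) (suc m)
    ≤⟨ *-mono-≤ (ball-monoˡ m (≤-trans k≤ (≤-reflexive (lemma₁ (suc m))))) (ball-monoˡ (suc m) le) ⟩
  ball (32 * (2 * suc m)) m * ball (32 * (3 * suc m)) (suc m)
    ≤⟨ bound (suc m) ⟩
  2 ^ (5 * m + 2 * (2 * suc m) + (5 * suc m + 2 * (3 * suc m)))
    -- The exponent equals 15 + 20 m. It is relaxed to c + 32 m to meet the lower bound for R(K_k),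
    -- which is about 2^(32 m) when k is about 64 m.
    ≤⟨ ^-monoʳ-≤ 2 (≤-trans (≤-reflexive (lemma₂ m)) (+-mono-≤ 15≤c (*-monoˡ-≤ m (≤ᵇ⇒≤ 20 32 tt)))) ⟩
  2 ^ (c + 32 * m)
    ≡⟨ ^-distribˡ-+-* 2 c (32 * m) ⟩
  2 ^ c * 2 ^ (32 * m) ∎
  where
  open ≤-Reasoning
  bound : ∀ s → ball (32 * (2 * s)) m * ball (32 * (3 * s)) s ≤ 2 ^ (5 * m + 2 * (2 * s) + (5 * s + 2 * (3 * s)))
  bound s = ≤-trans (*-mono-≤ (ball-power (2 * s) m) (ball-power (3 * s) s))
              (≤-reflexive (sym (^-distribˡ-+-* 2 (5 * m + 2 * (2 * s)) _)))
  lemma₁ : ∀ s → 64 * s ≡ 32 * (2 * s)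
  lemma₁ s = *-assoc 32 2 s
  lemma₂ : ∀ m → 5 * m + 2 * (2 * suc m) + (5 * suc m + 2 * (3 * suc m)) ≡ 15 + 20 * m
  lemma₂ = solve-∀
  lemma₃ : ∀ s → s + s + 64 * s + 30 * s ≡ 32 * (3 * s)
  lemma₃ = solve-∀
  le : suc m + suc k ≤ 32 * (3 * suc m)
  le = begin
    suc m + suc k                              ≤⟨ +-monoʳ-≤ (suc m) (+-mono-≤ (s≤s z≤n) k≤) ⟩
    suc m + (suc m + 64 * suc m)               ≡⟨ +-assoc (suc m) (suc m) _ ⟨
    suc m + suc m + 64 * suc m                 ≤⟨ m≤m+n _ _ ⟩
    suc m + suc m + 64 * suc m + 30 * suc m    ≡⟨ lemma₃ (suc m) ⟩
    32 * (3 * suc m)                           ∎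

-- From cliques on k vertices to cliques on k + 1

module _ {N : ℕ} (χ : Colouring N) where
  open Cliques χ

  -- The arrow relation is applied to the colouring pulled back along the positions of `xs`;
  -- uniqueness makes distinct positions distinct vertices.
  mono-clique : ∀ {M k} → Arrows M (complete k) → ∀ {xs} → Unique xs → M ≤ length xs → ∃[ c ] HasClique c k xs
  mono-clique {M} {k} arr {xs} xs! M≤ with arr (record
    { colour = λ u v → colour χ (lookup xs (inject≤ u M≤)) (lookup xs (inject≤ v M≤))
    ; symm   = λ u v → Colouring.symm χ _ _ })
  ... | c , φ , φ-inj , mono =
    c , tabulate ψ , ψ⊆ , length-tabulate ψ , AllPairs.tabulate⁺ {f = ψ} λ i≢j →
      (lookup-pair (λ x≢y → x≢y ∘ sym) xs! _ _ (i≢j ∘ φ-inj ∘ Finₚ.inject≤-injective M≤ M≤ _ _)) ,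
      mono _ _ (distinct-adjacent i≢j)
    where
    ψ : Fin k → Fin N
    ψ i = lookup xs (inject≤ (φ i) M≤)
    ψ⊆ : tabulate ψ ⊆ xs
    ψ⊆ p with ∈-tabulate⁻ p
    ... | i , refl = ∈-lookup (inject≤ (φ i) M≤)

  -- Starts from the empty clique and applies `enlarge` repeatedly. Since t ≤ k ≤ 64 (m + 1), the
  -- cost t D stays below 64 (m + 1) D, so one size condition on A serves all t after division by m
  -- + 1.
  sparse-clique : ∀ c m k b D {A} → Unique A → All (λ x → length (filter (¬? ∘ E? c x) A) ≤ D) A →
                  k ≤ 64 * suc m → 64 * D + ball k m * ball (suc m + b) (suc m) ≤ length A →
                  ∀ t → t ≤ k → HasClique c t A ⊎ HasClique (opposite c) b A
  sparse-clique c m k b D A! sparse k≤ le zero    _   = inj₁ ([] , (λ ()) , refl , [])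
  sparse-clique c m k b D {A} A! sparse k≤ le (suc t) t<k
    with sparse-clique c m k b D A! sparse k≤ le t (<⇒≤ t<k)
  ... | inj₂ q = inj₂ q
  ... | inj₁ q = enlarge c t m b D A! sparse (begin
    t * D + suc m * (ball t m * X)
      ≤⟨ +-mono-≤ (*-monoˡ-≤ D (≤-trans (<⇒≤ t<k) k≤)) (*-monoʳ-≤ (suc m) (*-monoˡ-≤ X (ball-monoˡ m (<⇒≤ t<k)))) ⟩
    64 * suc m * D + suc m * (ball k m * X)   ≡⟨ lemma (suc m) D (ball k m * X) ⟩
    suc m * (64 * D + ball k m * X)           ≤⟨ *-monoʳ-≤ (suc m) le ⟩
    suc m * length A                          ∎) q
    where
    open ≤-Reasoning
    X = ball (suc m + b) (suc m)
    lemma : ∀ s d x → 64 * s * d + s * x ≡ s * (64 * d + x)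
    lemma = solve-∀

  -- If some u in A has more than D points of A not joined to it in colour c, then, u itself apart,
  -- at least D of them are joined to u in the opposite colour. They contain a monochromatic K_k,
  -- which either has colour c or is completed by u. Otherwise A is sparse, and 65 D pays 64 D for
  -- the sparseness and D for the product of `ball`s.
  one-more : ∀ c m k D {A} → Unique A → Arrows D (complete k) → k ≤ 64 * suc m →
             ball k m * ball (suc m + suc k) (suc m) ≤ D → 65 * D ≤ length A →
             HasClique c k A ⊎ HasClique (opposite c) (suc k) A
  one-more c m k D {A} A! arr k≤ ball≤ le with Any.any? (λ x → D <? length (filter (¬? ∘ E? c x) A)) A
  ... | no none = sparse-clique c m k (suc k) D A! (All.map ≮⇒≥ (All.¬Any⇒All¬ A none)) k≤
                    (≤-trans (≤-reflexive (+-comm (64 * D) _)) (≤-trans (+-monoˡ-≤ (64 * D) ball≤) le)) k ≤-refl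
  ... | yes some with find some
  ...   | u , u∈A , D< with mono-clique arr (AllPairs.filter⁺ (λ x → ¬? (u Finₚ.≟ x)) (AllPairs.filter⁺ (¬? ∘ E? c u) A!))
                              (s≤s⁻¹ (≤-trans D< (length-delete u (AllPairs.filter⁺ (¬? ∘ E? c u) A!))))
  ...     | d , q with colour-dichotomy c d
  ...       | inj₁ refl = inj₁ (widen (filter-⊆ (¬? ∘ E? c u) A ∘ filter-⊆ (λ x → ¬? (u Finₚ.≟ x)) _) q)
  ...       | inj₂ refl = inj₂ (cons u∈A id (widen joined q))
    where
    joined : delete u (filter (¬? ∘ E? c u) A) ⊆ filter (E? (opposite c) u) A
    joined p with ∈-filter⁻ (λ x → ¬? (u Finₚ.≟ x)) {xs = filter (¬? ∘ E? c u) A} p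
    ... | p′ , u≢x with ∈-filter⁻ (¬? ∘ E? c u) {xs = A} p′
    ...   | x∈A , ¬e = ∈-filter⁺ (E? (opposite c) u) x∈A (Sum.[ ⊥-elim ∘ ¬e , id ] (E-cover c u≢x))

-- The vertex `zero` has at least 65 D neighbours in some colour c. It extends every clique of
-- colour c among them, which is why `one-more` need only produce k vertices in that colour.
arrows-suc : ∀ m k D N → Arrows D (complete k) → k ≤ 64 * suc m →
             ball k m * ball (suc m + suc k) (suc m) ≤ D → 65 * D + 65 * D ≤ N →
             Arrows (suc N) (complete (suc k))
arrows-suc m k D N arr k≤ ball≤ D≤N χ with found
  where
  open Cliques χ
  xs : List (Fin (suc N))
  xs = tabulate suc

  all! : Unique (zero ∷ xs)
  all! = Unique.allFin⁺ (suc N)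

  lift : ∀ c → 65 * D ≤ length (filter (E? c zero) xs) → ∃[ d ] HasClique d (suc k) (zero ∷ xs)
  lift c le with one-more χ c m k D (AllPairs.filter⁺ (E? c zero) (AllPairs.tail all!)) arr k≤ ball≤ le
  ... | inj₁ q = c , cons (here refl) there q
  ... | inj₂ q = opposite c , widen (there ∘ filter-⊆ (E? c zero) xs) q

  open ≤-Reasoning
  found : ∃[ d ] HasClique d (suc k) (zero ∷ xs)
  found = Sum.[ lift red , lift blue ]′ (+-≤-split (begin
    65 * D + 65 * D ≤⟨ D≤N ⟩
    N               ≡⟨ length-tabulate {n = N} suc ⟨
    length xs       ≤⟨ length-filter-cover (E? red zero) (E? blue zero)
                         (All.map (E-cover red) (AllPairs.head all!)) ⟩
    length (filter (E? red zero) xs) + length (filter (E? blue zero) xs) ≤⟨ n≤1+n _ ⟩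
    suc (length (filter (E? red zero) xs) + length (filter (E? blue zero) xs)) ∎))
... | d , ys , _ , len , mono = clique⇒copy (complete (suc k)) χ (ys , len , mono)

-- The exponential lower bound

-- A subcube of the colour vectors, with `nothing` at unconstrained coordinates. It encodes the
-- event that a given clique is monochromatic in a given colour.
Pattern : ℕ → Set
Pattern n = Vec (Maybe Colour) n

free : ∀ {n} → Pattern n → ℕ
free []            = 0
free (nothing ∷ p) = suc (free p)
free (just _  ∷ p) = free p

Matches : ∀ {n} → Vec Colour n → Pattern n → Set
Matches x p = ∀ e {c} → Vec.lookup p e ≡ just c → Vec.lookup x e ≡ c

total : ∀ {n} → List (Pattern n) → ℕ
total = sum ∘ map (λ p → 2 ^ free p)

-- Conditioning on the first coordinate: patterns that demand the other colour there can no longer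
-- be matched and disappear.
restrict : ∀ {n} → Colour → List (Pattern (suc n)) → List (Pattern n)
restrict d [] = []
restrict d ((nothing ∷ p) ∷ ps) = p ∷ restrict d ps
restrict d ((just c ∷ p) ∷ ps) with c Finₚ.≟ d
... | yes _ = p ∷ restrict d ps
... | no  _ = restrict d ps

-- A pattern with free first coordinate passes half of its weight to each side; a constrained one
-- passes all of it to one side.
total-restrict : ∀ {n} (ps : List (Pattern (suc n))) →
                 total (restrict red ps) + total (restrict blue ps) ≡ total ps
total-restrict [] = refl
total-restrict ((nothing ∷ p) ∷ ps) =
  trans (lemma (2 ^ free p) (total (restrict red ps)) _) (cong (2 * 2 ^ free p +_) (total-restrict ps))
  where
  lemma : ∀ a b c → (a + b) + (a + c) ≡ 2 * a + (b + c)
  lemma = solve-∀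
total-restrict ((just zero ∷ p) ∷ ps) =
  trans (+-assoc (2 ^ free p) _ _) (cong (2 ^ free p +_) (total-restrict ps))
total-restrict ((just (suc zero) ∷ p) ∷ ps) =
  trans (x∙yz≈y∙xz +-commutativeSemigroup (total (restrict red ps)) (2 ^ free p) _)
    (cong (2 ^ free p +_) (total-restrict ps))

total-++ : ∀ {n} (ps qs : List (Pattern n)) → total (ps ++ qs) ≡ total ps + total qs
total-++ ps qs = trans (cong sum (map-++ (λ p → 2 ^ free p) ps qs))
                       (sum-++ (map (λ p → 2 ^ free p) ps) (map (λ p → 2 ^ free p) qs))

avoids-∷ : ∀ {n} d {x : Vec Colour n} ps →
           All (¬_ ∘ Matches x) (restrict d ps) → All (¬_ ∘ Matches (d ∷ x)) ps
avoids-∷ d []                   _        = []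
avoids-∷ d ((nothing ∷ p) ∷ ps) (¬m ∷ a) = (λ m → ¬m (m ∘ suc)) ∷ avoids-∷ d ps a
avoids-∷ d ((just c ∷ p) ∷ ps) a with c Finₚ.≟ d
avoids-∷ d ((just c ∷ p) ∷ ps) (¬m ∷ a) | yes _ = (λ m → ¬m (m ∘ suc)) ∷ avoids-∷ d ps a
avoids-∷ d ((just c ∷ p) ∷ ps) a | no c≢d = (λ m → c≢d (sym (m zero refl))) ∷ avoids-∷ d ps a

-- The method of conditional expectations: total ps / 2 ^ n is the expected number of
-- patterns that a random vector matches.
avoid : ∀ {n} (ps : List (Pattern n)) → total ps < 2 ^ n → ∃[ x ] All (¬_ ∘ Matches x) ps
avoid {zero}  []        _        = [] , []
avoid {zero}  ([] ∷ ps) (s≤s ())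
avoid {suc n} ps        lt with total (restrict red ps) <? 2 ^ n
... | yes lt₀ with avoid (restrict red ps) lt₀
...   | x , a = zero ∷ x , avoids-∷ zero ps a
avoid {suc n} ps lt | no ¬lt₀ with avoid (restrict blue ps) (+-cancelˡ-< (2 ^ n) _ _ (begin-strict
    2 ^ n + total (restrict blue ps)                     ≤⟨ +-monoˡ-≤ _ (≮⇒≥ ¬lt₀) ⟩
    total (restrict red ps) + total (restrict blue ps)  ≡⟨ total-restrict ps ⟩
    total ps                                                   <⟨ lt ⟩
    2 * 2 ^ n                                                  ≡⟨ cong (2 ^ n +_) (+-identityʳ _) ⟩
    2 ^ n + 2 ^ n                                              ∎))
  where open ≤-Reasoning
... | x , a = suc zero ∷ x , avoids-∷ (suc zero) ps a

stamp : ∀ {n} → Colour → List (Fin n) → Pattern n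
stamp c []      = replicate _ nothing
stamp c (e ∷ L) = stamp c L [ e ]≔ just c

free-update : ∀ {n} (p : Pattern n) e {c} → Vec.lookup p e ≡ nothing → suc (free (p [ e ]≔ just c)) ≡ free p
free-update (nothing ∷ p) zero    _  = refl
free-update (nothing ∷ p) (suc e) eq = cong suc (free-update p e eq)
free-update (just _  ∷ p) (suc e) eq = free-update p e eq

free-replicate : ∀ n → free (replicate n nothing) ≡ n
free-replicate zero    = refl
free-replicate (suc n) = cong suc (free-replicate n)

lookup-stamp : ∀ {n} c {e : Fin n} {L} → All (e ≢_) L → Vec.lookup (stamp c L) e ≡ nothing
lookup-stamp c {e} []                   = lookup-replicate e nothing
lookup-stamp c {e} {e′ ∷ L} (e≢e′ ∷ e∉L) = trans (lookup∘updateAt′ e e′ e≢e′ (stamp c L)) (lookup-stamp c e∉L)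

free-stamp : ∀ {n} c {L : List (Fin n)} → Unique L → free (stamp c L) + length L ≡ n
free-stamp c []                      = trans (+-identityʳ _) (free-replicate _)
free-stamp c {e ∷ L} (e∉L ∷ L!) = trans (+-suc _ _)
  (trans (cong (_+ length L) (free-update (stamp c L) e (lookup-stamp c e∉L))) (free-stamp c L!))

matches-stamp : ∀ {n} {c} {x : Vec Colour n} {L} → All (λ e → Vec.lookup x e ≡ c) L → Matches x (stamp c L)
matches-stamp [] e eq with () ← trans (sym eq) (lookup-replicate e nothing)
matches-stamp {c = c} {x} {e′ ∷ L} (h ∷ hs) e eq with e Finₚ.≟ e′
... | yes refl = trans h (just-injective (trans (sym (lookup∘updateAt e (stamp c L))) eq))
... | no e≢e′  = matches-stamp {x = x} hs e (trans (sym (lookup∘updateAt′ e e′ e≢e′ (stamp c L))) eq)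

-- Monochromatic cliques as patterns

module _ {N : ℕ} where

  -- Unordered pairs are normalised with the smaller vertex first, so that any vector of N * N
  -- colours yields a symmetric colouring.
  edge : Fin N → Fin N → Fin (N * N)
  edge u v with u Finₚ.≤? v
  ... | yes _ = combine u v
  ... | no  _ = combine v u

  edge-sym : ∀ u v → edge u v ≡ edge v u
  edge-sym u v with u Finₚ.≤? v | v Finₚ.≤? u
  ... | yes p | yes q rewrite Finₚ.≤-antisym p q = refl
  ... | yes _ | no  _ = refl
  ... | no  _ | yes _ = refl
  ... | no ¬p | no ¬q = ⊥-elim (Sum.[ ¬p , ¬q ]′ (Finₚ.≤-total u v))

  edge-injective : ∀ u v a b → edge u v ≡ edge a b → (u ≡ a × v ≡ b) ⊎ (u ≡ b × v ≡ a)
  edge-injective u v a b eq with u Finₚ.≤? v | a Finₚ.≤? b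
  ... | yes _ | yes _ = inj₁ (Finₚ.combine-injective u v a b eq)
  ... | yes _ | no  _ = inj₂ (Finₚ.combine-injective u v b a eq)
  ... | no  _ | yes _ with Finₚ.combine-injective v u a b eq
  ...   | v≡a , u≡b = inj₂ (u≡b , v≡a)
  edge-injective u v a b eq | no _ | no _ with Finₚ.combine-injective v u b a eq
  ... | v≡b , u≡a = inj₁ (u≡a , v≡b)

  edges : List (Fin N) → List (Fin (N * N))
  edges []       = []
  edges (x ∷ xs) = map (edge x) xs ++ edges xs

  ∈-edges⁻ : ∀ {e} xs → e ∈ edges xs → ∃[ a ] ∃[ b ] a ∈ xs × b ∈ xs × e ≡ edge a b
  ∈-edges⁻ (x ∷ xs) e∈ with ∈-++⁻ (map (edge x) xs) e∈
  ... | inj₁ p with ∈-map⁻ (edge x) p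
  ...   | b , b∈ , refl = x , b , here refl , there b∈ , refl
  ∈-edges⁻ (x ∷ xs) e∈ | inj₂ p with ∈-edges⁻ xs p
  ... | a , b , a∈ , b∈ , eq = a , b , there a∈ , there b∈ , eq

  edges-unique : ∀ {xs} → Unique xs → Unique (edges xs)
  edges-unique [] = []
  edges-unique {x ∷ xs} (x∉xs ∷ xs!) =
    Unique.++⁺ (Unique.map⁺ edge-injectiveʳ xs!) (edges-unique xs!) disjoint
    where
    edge-injectiveʳ : ∀ {u v} → edge x u ≡ edge x v → u ≡ v
    edge-injectiveʳ {u} {v} eq with edge-injective x u x v eq
    ... | inj₁ (_ , u≡v)   = u≡v
    ... | inj₂ (x≡v , u≡x) = trans u≡x x≡v
    disjoint : ∀ {e} → ¬ (e ∈ map (edge x) xs × e ∈ edges xs)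
    disjoint (p , q) with ∈-map⁻ (edge x) p | ∈-edges⁻ xs q
    ... | y , _ , refl | a , b , a∈ , b∈ , eq with edge-injective x y a b eq
    ...   | inj₁ (refl , _) = All.lookup x∉xs a∈ refl
    ...   | inj₂ (refl , _) = All.lookup x∉xs b∈ refl

  edges-all : ∀ {p} {P : Pred (Fin (N * N)) p} {xs} → AllPairs (λ u v → P (edge u v)) xs → All P (edges xs)
  edges-all []       = []
  edges-all (p ∷ ps) = All.++⁺ (All.map⁺ p) (edges-all ps)

-- The binomial coefficient k choose 2, in the recursive form in which `edges` produces it.
triangular : ℕ → ℕ
triangular zero    = 0
triangular (suc k) = k + triangular k

length-edges : ∀ {N} (xs : List (Fin N)) → length (edges xs) ≡ triangular (length xs)
length-edges []       = refl
length-edges (x ∷ xs) = trans (length-++ (map (edge x) xs)) (cong₂ _+_ (length-map (edge x) xs) (length-edges xs))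

triangular-square : ∀ k → 2 * triangular k + k ≡ k * k
triangular-square zero    = refl
triangular-square (suc k) = trans (lemma k (triangular k))
  (trans (cong (2 * k + 1 +_) (triangular-square k)) (lemma′ k))
  where
  lemma : ∀ k t → 2 * (k + t) + suc k ≡ 2 * k + 1 + (2 * t + k)
  lemma = solve-∀
  lemma′ : ∀ k → 2 * k + 1 + k * k ≡ suc k * suc k
  lemma′ = solve-∀

tuple : ∀ N k → Fin (N ^ k) → List (Fin N)
tuple N k i = tabulate (finToFun {N} {k} i)

-- Ordered tuples, so each k-element vertex set occurs k! times; the crude count N^k suffices for an
-- exponential bound.
tuples : ∀ N k → List (List (Fin N))
tuples N k = filter (Unique.unique? Finₚ._≟_) (map (tuple N k) (allFin (N ^ k)))

length-tuples : ∀ N k → length (tuples N k) ≤ N ^ k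
length-tuples N k = begin
  length (tuples N k)
    ≤⟨ length-filter (Unique.unique? Finₚ._≟_) (map (tuple N k) (allFin (N ^ k))) ⟩
  length (map (tuple N k) (allFin (N ^ k))) ≡⟨ length-map (tuple N k) (allFin (N ^ k)) ⟩
  length (allFin (N ^ k))                   ≡⟨ length-tabulate {n = N ^ k} id ⟩
  N ^ k                                     ∎
  where open ≤-Reasoning

∈-tuples⁺ : ∀ {N k} {φ : Fin k → Fin N} → Injective _≡_ _≡_ φ → tabulate φ ∈ tuples N k
∈-tuples⁺ {N} {k} {φ} φ-inj = ∈-filter⁺ (Unique.unique? Finₚ._≟_)
  (subst (_∈ map (tuple N k) (allFin (N ^ k))) (tabulate-cong (Finₚ.finToFun-funToFin φ))
    (∈-map⁺ (tuple N k) (∈-allFin (funToFin φ))))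
  (Unique.tabulate⁺ φ-inj)

∈-tuples⁻ : ∀ {N k xs} → xs ∈ tuples N k → length xs ≡ k × Unique xs
∈-tuples⁻ {N} {k} xs∈ with ∈-filter⁻ (Unique.unique? Finₚ._≟_) {xs = map (tuple N k) (allFin (N ^ k))} xs∈
... | p , xs! with ∈-map⁻ (tuple N k) p
...   | i , _ , eq = trans (cong length eq) (length-tabulate (finToFun {N} {k} i)) , xs!

cliquePatterns : ∀ N k → Colour → List (Pattern (N * N))
cliquePatterns N k c = map (stamp c ∘ edges) (tuples N k)

-- Each of the at most N^k patterns fixes k choose 2 distinct coordinates. The factor on the left
-- replaces a subtraction in the exponent.
total-cliquePatterns : ∀ N k c → total (cliquePatterns N k c) * 2 ^ triangular k ≤ N ^ k * 2 ^ (N * N)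
total-cliquePatterns N k c = ≤-trans (go (tuples N k) (All.tabulate weight)) (*-monoˡ-≤ _ (length-tuples N k))
  where
  weight : ∀ {xs} → xs ∈ tuples N k → 2 ^ free (stamp c (edges xs)) * 2 ^ triangular k ≡ 2 ^ (N * N)
  weight {xs} xs∈ with ∈-tuples⁻ {N} {k} xs∈
  ... | refl , xs! = trans (sym (^-distribˡ-+-* 2 (free (stamp c (edges xs))) _))
    (cong (2 ^_) (trans (cong (free (stamp c (edges xs)) +_) (sym (length-edges xs))) (free-stamp c (edges-unique xs!))))

  go : ∀ xss → All (λ xs → 2 ^ free (stamp c (edges xs)) * 2 ^ triangular k ≡ 2 ^ (N * N)) xss →
       total (map (stamp c ∘ edges) xss) * 2 ^ triangular k ≤ length xss * 2 ^ (N * N)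
  go []         []         = z≤n
  go (xs ∷ xss) (eq ∷ eqs) = begin
    (2 ^ free (stamp c (edges xs)) + total (map (stamp c ∘ edges) xss)) * 2 ^ triangular k
      ≡⟨ *-distribʳ-+ (2 ^ triangular k) (2 ^ free (stamp c (edges xs))) _ ⟩
    2 ^ free (stamp c (edges xs)) * 2 ^ triangular k + total (map (stamp c ∘ edges) xss) * 2 ^ triangular k
      ≤⟨ +-mono-≤ (≤-reflexive eq) (go xss eqs) ⟩
    2 ^ (N * N) + length xss * 2 ^ (N * N) ∎
    where open ≤-Reasoning

-- Erdős's lower bound: a random colouring has on average fewer than one monochromatic ordered
-- k-tuple, and `avoid` turns this average into an actual colouring with none.
¬arrows-complete : ∀ N k → 2 * N ^ k < 2 ^ triangular k → ¬ Arrows N (complete k)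
¬arrows-complete N k lt arr with avoid (cliquePatterns N k red ++ cliquePatterns N k blue) few
  where
  open ≤-Reasoning
  few : total (cliquePatterns N k red ++ cliquePatterns N k blue) < 2 ^ (N * N)
  few = *-cancelʳ-< (2 ^ triangular k) _ _ (begin-strict
    total (cliquePatterns N k red ++ cliquePatterns N k blue) * 2 ^ triangular k
      ≡⟨ cong (_* 2 ^ triangular k) (total-++ (cliquePatterns N k red) (cliquePatterns N k blue)) ⟩
    (total (cliquePatterns N k red) + total (cliquePatterns N k blue)) * 2 ^ triangular k
      ≡⟨ *-distribʳ-+ (2 ^ triangular k) (total (cliquePatterns N k red)) (total (cliquePatterns N k blue)) ⟩
    total (cliquePatterns N k red) * 2 ^ triangular k + total (cliquePatterns N k blue) * 2 ^ triangular k
      ≤⟨ +-mono-≤ (total-cliquePatterns N k red) (total-cliquePatterns N k blue) ⟩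
    N ^ k * 2 ^ (N * N) + N ^ k * 2 ^ (N * N)
      ≡⟨ lemma (N ^ k) (2 ^ (N * N)) ⟩
    2 * N ^ k * 2 ^ (N * N)
      <⟨ *-monoˡ-< (2 ^ (N * N)) {{m^n≢0 2 (N * N)}} lt ⟩
    2 ^ triangular k * 2 ^ (N * N)
      ≡⟨ *-comm (2 ^ triangular k) _ ⟩
    2 ^ (N * N) * 2 ^ triangular k ∎)
    where
    lemma : ∀ a b → a * b + a * b ≡ 2 * a * b
    lemma = solve-∀
... | x , avoids with arr (record { colour = λ u v → Vec.lookup x (edge u v)
                                  ; symm = λ u v → cong (Vec.lookup x) (edge-sym u v) })
...   | c , φ , φ-inj , mono =
  All.lookup avoids (∈-cliquePatterns c (∈-map⁺ (stamp c ∘ edges) (∈-tuples⁺ φ-inj)))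
    (matches-stamp {x = x} (edges-all (AllPairs.tabulate⁺ λ {i} {j} i≢j → mono i j (distinct-adjacent i≢j))))
  where
  ∈-cliquePatterns : ∀ c {p} → p ∈ cliquePatterns N k c → p ∈ cliquePatterns N k red ++ cliquePatterns N k blue
  ∈-cliquePatterns zero       = ∈-++⁺ˡ {ys = cliquePatterns N k blue}
  ∈-cliquePatterns (suc zero) = ∈-++⁺ʳ (cliquePatterns N k red)

arrows-mono : ∀ G {M N} → M ≤ N → Arrows M G → Arrows N G
arrows-mono G M≤N arr χ with arr (record
  { colour = λ u v → colour χ (inject≤ u M≤N) (inject≤ v M≤N) ; symm = λ u v → Colouring.symm χ _ _ })
... | c , φ , φ-inj , mono = c , (λ u → inject≤ (φ u) M≤N) , φ-inj ∘ Finₚ.inject≤-injective M≤N M≤N _ _ , mono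

-- Take N = 2^a in `¬arrows-complete`: from k ≥ 2 a + 3 it follows that k choose 2 is at least a k +
-- k, which exceeds a k + 1.
R-exponential : ∀ a k → 2 * a + 3 ≤ k → 2 ^ a < R (complete k)
R-exponential a k le with 2 ^ a <? R (complete k)
... | yes lt = lt
... | no ¬lt = ⊥-elim (¬arrows-complete (2 ^ a) k (begin-strict
    2 * (2 ^ a) ^ k   ≡⟨ cong (2 *_) (^-*-assoc 2 a k) ⟩
    2 ^ suc (a * k)   <⟨ ^-monoʳ-< 2 (s≤s (s≤s z≤n)) exponents ⟩
    2 ^ triangular k  ∎) (arrows-mono (complete k) (≮⇒≥ ¬lt) (R-arrows (complete k))))
  where
  open ≤-Reasoning
  lemma : ∀ a k → 2 * (a * k + k) + k ≡ k * (2 * a + 3)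
  lemma = solve-∀
  exponents : suc (a * k) < triangular k
  exponents = begin-strict
    suc (a * k)  ≡⟨ +-comm 1 (a * k) ⟩
    a * k + 1    <⟨ +-monoʳ-< (a * k) (≤-trans (s≤s (s≤s z≤n)) (≤-trans (m≤n+m 3 (2 * a)) le)) ⟩
    a * k + k    ≤⟨ *-cancelˡ-≤ 2 (+-cancelʳ-≤ k _ _ (begin
      2 * (a * k + k) + k   ≡⟨ lemma a k ⟩
      k * (2 * a + 3)       ≤⟨ *-monoʳ-≤ k le ⟩
      k * k                 ≡⟨ triangular-square k ⟨
      2 * triangular k + k  ∎)) ⟩
    triangular k ∎

-- Consecutive clique Ramsey numbers

R-complete-pos : ∀ k → 0 < R (complete (suc k))
R-complete-pos k = n≢0⇒n>0 λ eq → empty (subst (λ N → Arrows N (complete (suc k))) eq (R-arrows (complete (suc k))))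
  where
  empty : ¬ Arrows 0 (complete (suc k))
  empty arr with arr (record { colour = λ () ; symm = λ () })
  ... | _ , φ , _ with () ← φ zero

-- For m > 0, `R-exponential` is used with a = 32 m - 2, for which 2 a + 3 = 64 m - 1; the factor 4
-- makes up for the 2 subtracted in the exponent.
R-exponential-64 : ∀ m k → 64 * m ≤ suc k → 2 ^ (32 * m) ≤ 4 * R (complete (suc k))
R-exponential-64 zero    k le = ≤-trans (R-complete-pos k) (m≤m+n _ _)
R-exponential-64 (suc m) k le =
  rescale (32 * suc m) (32 * m + 30) (exponent m) (<⇒≤ (R-exponential (32 * m + 30) (suc k) (begin
    2 * (32 * m + 30) + 3      ≤⟨ n≤1+n _ ⟩
    suc (2 * (32 * m + 30) + 3) ≡⟨ double m ⟩
    64 * suc m                 ≤⟨ le ⟩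
    suc k                      ∎)))
  where
  open ≤-Reasoning
  exponent : ∀ m → 32 * suc m ≡ 2 + (32 * m + 30)
  exponent = solve-∀
  double : ∀ m → suc (2 * (32 * m + 30) + 3) ≡ 64 * suc m
  double = solve-∀
  rescale : ∀ e a {r} → e ≡ 2 + a → 2 ^ a ≤ r → 2 ^ e ≤ 4 * r
  rescale e a {r} refl le = ≤-trans (≤-reflexive (sym (*-assoc 2 2 (2 ^ a)))) (*-monoʳ-≤ 4 le)

R-suc : ∀ c → 15 ≤ c → ∀ k →
        R (complete (suc (suc k))) ≤ 131 * (2 ^ c * 4) * R (complete (suc k))
R-suc c 15≤c k = begin
  R (complete (suc (suc k)))
    ≤⟨ R-least (complete (suc (suc k))) (arrows-suc m (suc k) D (65 * D + 65 * D)
         (arrows-mono (complete (suc k)) M≤D (R-arrows (complete (suc k)))) k≤ ball≤ ≤-refl) ⟩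
  -- The additional vertex of `arrows-suc` is absorbed by a further D, whence 131 = 65 + 65 + 1.
  1 + (65 * D + 65 * D)   ≤⟨ +-monoˡ-≤ (65 * D + 65 * D) (≤-trans (R-complete-pos k) M≤D) ⟩
  D + (65 * D + 65 * D)   ≡⟨ lemma D ⟩
  131 * D                 ≡⟨ cong (131 *_) (*-assoc (2 ^ c) 4 M) ⟨
  131 * (2 ^ c * 4 * M)   ≡⟨ *-assoc 131 (2 ^ c * 4) M ⟨
  131 * (2 ^ c * 4) * M   ∎
  where
  open ≤-Reasoning
  -- Both roundings matter: suc k ≤ 64 (m + 1) feeds `arrows-suc`, while 64 m ≤ suc k feeds the
  -- exponential lower bound.
  m = suc k / 64
  M = R (complete (suc k))
  -- A multiple of M that is at least M, so that it still arrows, and by 2^(32 m) ≤ 4 M also bounds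
  -- the product in `ball-product`.
  D = 2 ^ c * (4 * M)
  lemma : ∀ d → d + (65 * d + 65 * d) ≡ 131 * d
  lemma = solve-∀
  M≤D : M ≤ D
  M≤D = ≤-trans (m≤m+n M (3 * M)) (m≤n*m (4 * M) (2 ^ c) {{m^n≢0 2 c}})
  k≤ : suc k ≤ 64 * suc m
  k≤ = begin
    suc k                     ≡⟨ m≡m%n+[m/n]*n (suc k) 64 ⟩
    suc k % 64 + m * 64       ≤⟨ +-monoˡ-≤ (m * 64) (<⇒≤ (m%n<n (suc k) 64)) ⟩
    suc m * 64                ≡⟨ *-comm (suc m) 64 ⟩
    64 * suc m                ∎
  ball≤ : ball (suc k) m * ball (suc m + suc (suc k)) (suc m) ≤ D
  ball≤ = ≤-trans (ball-product c m (suc k) 15≤c k≤) (*-monoʳ-≤ (2 ^ c)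
    (R-exponential-64 m k (≤-trans (≤-reflexive (*-comm 64 m)) (m/n*n≤m (suc k) 64))))

-- Kites

module _ (n k : ℕ) where

  -- With the hub numbered `zero` and the clique numbered first, a copy can be read off from one
  -- list of vertices, as `copy-kite` does.
  KiteAdj : Fin (suc n) → Fin (suc n) → Set
  KiteAdj u v = u ≢ v × (toℕ u < k × toℕ v < k ⊎ u ≡ zero ⊎ v ≡ zero)

  kiteAdj? : ∀ u v → Dec (KiteAdj u v)
  kiteAdj? u v =
    ¬? (u Finₚ.≟ v) ×-dec ((toℕ u <? k ×-dec toℕ v <? k) ⊎-dec (u Finₚ.≟ zero ⊎-dec v Finₚ.≟ zero))

  kiteAdj-sym : ∀ {u v} → KiteAdj u v → KiteAdj v u
  kiteAdj-sym (u≢v , e) = (u≢v ∘ sym) , Sum.map Product.swap Sum.swap e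

  kite : Graph
  kite = record
    { order  = suc n
    ; adj    = λ u v → does (kiteAdj? u v)
    ; symm   = λ u v → does-⇔ (mk⇔ kiteAdj-sym kiteAdj-sym) (kiteAdj? u v) (kiteAdj? v u)
    ; irrefl = λ v → dec-false (kiteAdj? v v) (λ (v≢v , _) → v≢v refl)
    }

  kiteAdj⁺ : ∀ {u v} → KiteAdj u v → Graph.Adj kite u v
  kiteAdj⁺ {u} {v} = dec-true (kiteAdj? u v)

  kiteAdj⁻ : ∀ {u v} → Graph.Adj kite u v → KiteAdj u v
  kiteAdj⁻ {u} {v} eq = does⁻ (kiteAdj? u v) eq
    where
    does⁻ : ∀ {A : Set} (a? : Dec A) → does a? ≡ true → A
    does⁻ (yes a) _ = a

  kite-connected : Connected kite
  kite-connected = _ , λ u v → walk u v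
    where
    from-hub : ∀ v → Star (Graph.Adj kite) zero v
    from-hub zero    = ε
    from-hub (suc v) = kiteAdj⁺ {zero} {suc v} ((λ ()) , inj₂ (inj₁ refl)) ◅ ε
    walk : ∀ u v → Star (Graph.Adj kite) u v
    walk zero    v = from-hub v
    walk (suc u) v = kiteAdj⁺ {suc u} {zero} ((λ ()) , inj₂ (inj₂ refl)) ◅ from-hub v

  arrows-complete : ∀ {N} → k ≤ suc n → Arrows N kite → Arrows N (complete k)
  arrows-complete k≤ arr χ with arr χ
  ... | c , φ , φ-inj , mono = c , (λ i → φ (inject≤ i k≤)) , Finₚ.inject≤-injective k≤ k≤ _ _ ∘ φ-inj ,
        λ i j ij → mono _ _ (kiteAdj⁺ (distinct ij ∘ Finₚ.inject≤-injective k≤ k≤ i j , inj₁ (bound i , bound j)))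
    where
    bound : ∀ i → toℕ (inject≤ i k≤) < k
    bound i = subst (_< k) (sym (Finₚ.toℕ-inject≤ i k≤)) (Finₚ.toℕ<n i)
    distinct : ∀ {i j} → Graph.Adj (complete k) i j → i ≢ j
    distinct {i} ij refl with () ← trans (sym ij) (Graph.irrefl (complete k) i)

-- Lower bound for kites

module _ (j n : ℕ) where

  -- Chvátal's colouring: j red cliques on n vertices each, all other edges blue.
  block : Fin (j * n) → Fin (j * n) → Colour
  block u v with quotient {j} n u Finₚ.≟ quotient {j} n v
  ... | yes _ = red
  ... | no  _ = blue

  block-sym : ∀ u v → block u v ≡ block v u
  block-sym u v with quotient {j} n u Finₚ.≟ quotient {j} n v | quotient {j} n v Finₚ.≟ quotient {j} n u
  ... | yes _ | yes _ = refl
  ... | yes p | no ¬p = ⊥-elim (¬p (sym p))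
  ... | no ¬p | yes p = ⊥-elim (¬p (sym p))
  ... | no _  | no _  = refl

  block-red : ∀ u v → block u v ≡ red → quotient {j} n u ≡ quotient {j} n v
  block-red u v eq with quotient {j} n u Finₚ.≟ quotient {j} n v
  ... | yes p = p

  block-blue : ∀ u v → block u v ≡ blue → quotient {j} n u ≢ quotient {j} n v
  block-blue u v eq with quotient {j} n u Finₚ.≟ quotient {j} n v
  ... | no ¬p = ¬p

  quotient-remainder : ∀ u v → quotient {j} n u ≡ quotient {j} n v → remainder {j} n u ≡ remainder {j} n v → u ≡ v
  quotient-remainder u v q r = trans (sym (Finₚ.combine-remQuot {j} n u))
    (trans (cong₂ combine q r) (Finₚ.combine-remQuot {j} n v))

  -- A red kite would lie in the block of its hub, which has only n vertices; the j + 1 clique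
  -- vertices of a blue kite would lie in different blocks, of which there are only j.
  ¬arrows-kite : j ≤ n → ¬ Arrows (j * n) (kite n (suc j))
  ¬arrows-kite j≤n arr with arr (record { colour = block ; symm = block-sym })
  ... | zero , φ , φ-inj , mono = 1+n≰n (Finₚ.injective⇒≤ λ {u} {v} eq →
          φ-inj (quotient-remainder (φ u) (φ v) (trans (sym (same u)) (same v)) eq))
    where
    same : ∀ u → quotient {j} n (φ zero) ≡ quotient {j} n (φ u)
    same zero    = refl
    same (suc u) = block-red (φ zero) (φ (suc u))
      (mono zero (suc u) (kiteAdj⁺ n (suc j) {zero} {suc u} ((λ ()) , inj₂ (inj₁ refl))))
  ... | suc zero , φ , φ-inj , mono = 1+n≰n (Finₚ.injective⇒≤ part-injective)
    where
    core : Fin (suc j) → Fin (suc n)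
    core i = inject≤ i (s≤s j≤n)
    bound : ∀ i → toℕ (core i) < suc j
    bound i = subst (_< suc j) (sym (Finₚ.toℕ-inject≤ i (s≤s j≤n))) (Finₚ.toℕ<n i)
    part-injective : Injective _≡_ _≡_ (λ i → quotient {j} n (φ (core i)))
    part-injective {i} {i′} eq with i Finₚ.≟ i′
    ... | yes i≡i′ = i≡i′
    ... | no  i≢i′ = ⊥-elim (block-blue (φ (core i)) (φ (core i′))
      (mono (core i) (core i′) (kiteAdj⁺ n (suc j)
        (i≢i′ ∘ Finₚ.inject≤-injective (s≤s j≤n) (s≤s j≤n) i i′ , inj₁ (bound i , bound i′)))) eq)

-- Upper bound for kites

module _ {A : Set} {p q} {P : Pred A p} {Q : Pred A q} (P? : Decidable P) (Q? : Decidable Q) where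

  length-filter-filter : ∀ xs → length (filter P? (filter Q? xs)) ≤ length (filter P? xs)
  length-filter-filter [] = z≤n
  length-filter-filter (x ∷ xs) with Q? x
  ... | no  _ = ≤-trans (length-filter-filter xs) (filter-∷≤ P? x xs)
  ... | yes _ with P? x
  ...   | yes _ = s≤s (length-filter-filter xs)
  ...   | no  _ = length-filter-filter xs

lookup-∈ˡ : ∀ {A : Set} (xs {ys} : List A) i → toℕ i < length xs → lookup (xs ++ ys) i ∈ xs
lookup-∈ˡ (x ∷ xs) zero    _         = here refl
lookup-∈ˡ (x ∷ xs) (suc i) (s≤s i<n) = there (lookup-∈ˡ xs i i<n)

lookup-pairˡ : ∀ {A : Set} {S : A → A → Set} → (∀ {x y} → S x y → S y x) →
               ∀ {xs ys} → AllPairs S xs → ∀ i j → toℕ i < length xs → toℕ j < length xs → i ≢ j →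
               S (lookup (xs ++ ys) i) (lookup (xs ++ ys) j)
lookup-pairˡ sy (p ∷ ps)           zero    zero    _         _         i≢j = ⊥-elim (i≢j refl)
lookup-pairˡ sy {x ∷ xs} (p ∷ ps)  zero    (suc j) _         (s≤s j<n) _   = All.lookup p (lookup-∈ˡ xs j j<n)
lookup-pairˡ sy {x ∷ xs} (p ∷ ps)  (suc i) zero    (s≤s i<n) _         _   = sy (All.lookup p (lookup-∈ˡ xs i i<n))
lookup-pairˡ sy (p ∷ ps)           (suc i) (suc j) (s≤s i<n) (s≤s j<n) i≢j =
  lookup-pairˡ sy ps i j i<n j<n (i≢j ∘ cong suc)

module _ {N : ℕ} (χ : Colouring N) where
  open Cliques χ

  -- Choosing a vertex and keeping its neighbours costs at most d vertices, itself included, and the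
  -- sparseness condition passes to sublists.
  greedy-clique : ∀ c d k {xs} → All (λ x → length (filter (¬? ∘ E? c x) xs) ≤ d) xs →
                  k * suc d ≤ length xs → HasClique c k xs
  greedy-clique c d zero    _ _ = [] , (λ ()) , refl , []
  greedy-clique c d (suc k) {x ∷ xs} (px ∷ pxs) le = cons (here refl) id
    (greedy-clique c d k
      (All.filter⁺ (E? c x) (All.map
        (λ {y} → ≤-trans (length-filter-filter (¬? ∘ E? c y) (E? c x) (x ∷ xs))) (px ∷ pxs)))
      (+-cancelʳ-≤ (suc d) _ _ (begin
        k * suc d + suc d  ≡⟨ +-comm (k * suc d) (suc d) ⟩
        suc k * suc d      ≤⟨ le ⟩
        length (x ∷ xs)    ≤⟨ length-filter-split (E? c x) (x ∷ xs) ⟩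
        length (filter (E? c x) (x ∷ xs)) + length (filter (¬? ∘ E? c x) (x ∷ xs)) ≤⟨ +-monoʳ-≤ _ (≤-trans px (n≤1+n d)) ⟩
        length (filter (E? c x) (x ∷ xs)) + suc d ∎)))
    where open ≤-Reasoning

  deleteAll : List (Fin N) → List (Fin N) → List (Fin N)
  deleteAll []       xs = xs
  deleteAll (u ∷ us) xs = delete u (deleteAll us xs)

  deleteAll-⊆ : ∀ us {xs} → deleteAll us xs ⊆ xs
  deleteAll-⊆ []       = id
  deleteAll-⊆ (u ∷ us) = deleteAll-⊆ us ∘ filter-⊆ (λ x → ¬? (u Finₚ.≟ x)) (deleteAll us _)

  deleteAll-unique : ∀ us {xs} → Unique xs → Unique (deleteAll us xs)
  deleteAll-unique []       xs! = xs!
  deleteAll-unique (u ∷ us) xs! = AllPairs.filter⁺ (λ x → ¬? (u Finₚ.≟ x)) (deleteAll-unique us xs!)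

  deleteAll-avoids : ∀ us xs → All (λ u → All (u ≢_) (deleteAll us xs)) us
  deleteAll-avoids []       xs = []
  deleteAll-avoids (u ∷ us) xs = All.all-filter (λ x → ¬? (u Finₚ.≟ x)) (deleteAll us xs) ∷
    All.map (All.filter⁺ (λ x → ¬? (u Finₚ.≟ x))) (deleteAll-avoids us xs)

  length-deleteAll : ∀ us {xs} → Unique xs → length xs ≤ length us + length (deleteAll us xs)
  length-deleteAll []       xs! = ≤-refl
  length-deleteAll (u ∷ us) xs! = ≤-trans (length-deleteAll us xs!)
    (≤-trans (+-monoʳ-≤ (length us) (length-delete u (deleteAll-unique us xs!))) (≤-reflexive (+-suc _ _)))

  -- The clique is listed first, headed by the hub q, followed by the vertices of `ys` outside `qs`.
  -- Deleting `qs` from `ys` removes at most as many vertices as `qs` contributes, so at least n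
  -- vertices follow the hub.
  copy-kite : ∀ {c q qs ys} n → AllPairs (E c) (q ∷ qs) → Unique ys → All (E c q) ys → n ≤ length ys →
              HasMonoCopy (kite n (suc (length qs))) (colour χ)
  copy-kite {c} {q} {qs} {ys} n Eqs@(Eq ∷ _) ys! Ey n≤ = c , φ , φ-injective , mono
    where
    open ≤-Reasoning
    L : List (Fin N)
    L = (q ∷ qs) ++ deleteAll qs ys

    hub : All (E c q) (qs ++ deleteAll qs ys)
    hub = All.++⁺ Eq (All-resp-⊇ (deleteAll-⊆ qs) Ey)

    L! : Unique L
    L! = AllPairs.++⁺ (AllPairs.map proj₁ Eqs) (deleteAll-unique qs ys!)
           (All.map proj₁ (All-resp-⊇ (deleteAll-⊆ qs) Ey) ∷ deleteAll-avoids qs ys)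

    n<L : suc n ≤ length L
    n<L = s≤s (begin
      n                                        ≤⟨ n≤ ⟩
      length ys                                ≤⟨ length-deleteAll qs ys! ⟩
      length qs + length (deleteAll qs ys)     ≡⟨ length-++ qs ⟨
      length (qs ++ deleteAll qs ys)           ∎)

    φ : Fin (suc n) → Fin N
    φ i = lookup L (inject≤ i n<L)

    position-≢ : ∀ {u v} → u ≢ v → inject≤ u n<L ≢ inject≤ v n<L
    position-≢ u≢v = u≢v ∘ Finₚ.inject≤-injective n<L n<L _ _

    φ-injective : Injective _≡_ _≡_ φ
    φ-injective {u} {v} eq with u Finₚ.≟ v
    ... | yes u≡v = u≡v
    ... | no  u≢v = ⊥-elim (lookup-pair (λ x≢y → x≢y ∘ sym) L! _ _ (position-≢ u≢v) eq)

    from-hub : ∀ v → zero ≢ v → E c (φ zero) (φ v)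
    from-hub zero    0≢0 = ⊥-elim (0≢0 refl)
    from-hub (suc v) _   = All.lookup hub (∈-lookup (inject≤ v (s≤s⁻¹ n<L)))

    joined : ∀ u v → KiteAdj n (suc (length qs)) u v → E c (φ u) (φ v)
    joined u v (u≢v , inj₁ (u<k , v<k)) = lookup-pairˡ E-sym Eqs _ _
      (subst (_< _) (sym (Finₚ.toℕ-inject≤ u n<L)) u<k) (subst (_< _) (sym (Finₚ.toℕ-inject≤ v n<L)) v<k)
      (position-≢ u≢v)
    joined u v (u≢v , inj₂ (inj₁ refl)) = from-hub v u≢v
    joined u v (u≢v , inj₂ (inj₂ refl)) = E-sym (from-hub u (u≢v ∘ sym))

    mono : ∀ u v → Graph.Adj (kite n (suc (length qs))) u v → colour χ (φ u) (φ v) ≡ c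
    mono u v uv = proj₂ (joined u v (kiteAdj⁻ n (suc (length qs)) uv))

  -- A vertex counts among its own non-neighbours, so a heavy vertex has at least n neighbours.
  Heavy : ℕ → Colour → Fin N → Set
  Heavy n c x = n < length (filter (¬? ∘ E? (opposite c) x) (allFin N))

  heavy? : ∀ n c x → Dec (Heavy n c x)
  heavy? n c x = n <? length (filter (¬? ∘ E? (opposite c) x) (allFin N))

  heavy-cover : ∀ n x → n + n < N → Heavy n red x ⊎ Heavy n blue x
  heavy-cover n x n<N with heavy? n red x | heavy? n blue x
  ... | yes h | _     = inj₁ h
  ... | no  _ | yes h = inj₂ h
  ... | no ¬h | no ¬h′ = ⊥-elim (<⇒≱ n<N (begin
    N ≡⟨ length-tabulate {n = N} id ⟨
    length (allFin N) ≤⟨ length-filter-cover (¬? ∘ E? blue x) (¬? ∘ E? red x) (All.universal one-colour (allFin N)) ⟩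
    length (filter (¬? ∘ E? blue x) (allFin N)) + length (filter (¬? ∘ E? red x) (allFin N))
      ≤⟨ +-mono-≤ (≮⇒≥ ¬h) (≮⇒≥ ¬h′) ⟩
    n + n ∎))
    where
    open ≤-Reasoning
    one-colour : ∀ y → ¬ E blue x y ⊎ ¬ E red x y
    one-colour y with E? blue x y
    ... | no ¬e        = inj₁ ¬e
    ... | yes (_ , eq) = inj₂ λ (_ , eq′) → Finₚ.0≢1+n (trans (sym eq′) eq)

  -- The head of the clique serves as hub: all vertices other than itself that are not joined to it
  -- in the opposite colour are joined to it in colour c, and heaviness provides n of them.
  copy-at-heavy : ∀ n k c {xs} → All (Heavy n c) xs → HasClique c (suc k) xs →
                  HasMonoCopy (kite n (suc k)) (colour χ)
  copy-at-heavy n k c heavy (q ∷ qs , ys⊆ , refl , Eqs) =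
    copy-kite n Eqs (AllPairs.filter⁺ (λ x → ¬? (q Finₚ.≟ x)) L!) (All.zipWith neighbour
        (All.filter⁺ (λ x → ¬? (q Finₚ.≟ x)) (All.all-filter (¬? ∘ E? (opposite c) q) (allFin N)) ,
         All.all-filter (λ x → ¬? (q Finₚ.≟ x)) L))
      (s≤s⁻¹ (≤-trans (All.lookup heavy (ys⊆ (here refl))) (length-delete q L!)))
    where
    L : List (Fin N)
    L = filter (¬? ∘ E? (opposite c) q) (allFin N)
    L! : Unique L
    L! = AllPairs.filter⁺ (¬? ∘ E? (opposite c) q) (Unique.allFin⁺ N)
    neighbour : ∀ {x} → ¬ E (opposite c) q x × q ≢ x → E c q x
    neighbour (¬e , q≢x) = Sum.[ id , ⊥-elim ∘ ¬e ]′ (E-cover c q≢x)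

  module _ (n : ℕ) where

    -- The names presuppose n + n < N, when `heavy-cover` makes every vertex that is not heavy in
    -- blue heavy in red.
    onlyRed blueHeavy onlyBlue bothHeavy : List (Fin N)
    onlyRed   = filter (¬? ∘ heavy? n blue) (allFin N)
    blueHeavy = filter (heavy? n blue) (allFin N)
    onlyBlue  = filter (¬? ∘ heavy? n red) blueHeavy
    bothHeavy = filter (heavy? n red) blueHeavy

    -- Not being heavy in one colour means having at most n non-neighbours in the other, so
    -- `greedy-clique` applies inside `onlyRed` and inside `onlyBlue`. If both are too small for it,
    -- `bothHeavy` has M vertices, and a monochromatic clique of either colour there has a possible
    -- hub.
    mono-kite : ∀ k M → Arrows M (complete (suc k)) → M + 2 * (suc k * suc n) + suc (n + n) ≤ N →
                HasMonoCopy (kite n (suc k)) (colour χ)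
    mono-kite k M arr le with +-≤-split {a = suc k * suc n} {suc k * suc n + M} (begin
        suc k * suc n + (suc k * suc n + M)     ≡⟨ lemma (suc k * suc n) M ⟩
        M + 2 * (suc k * suc n)                 ≤⟨ m≤m+n _ (suc (n + n)) ⟩
        M + 2 * (suc k * suc n) + suc (n + n)   ≤⟨ le ⟩
        N                                       ≡⟨ length-tabulate {n = N} id ⟨
        length (allFin N)                       ≤⟨ length-filter-split (heavy? n blue) (allFin N) ⟩
        length blueHeavy + length onlyRed       ≡⟨ +-comm (length blueHeavy) (length onlyRed) ⟩
        length onlyRed + length blueHeavy       ≤⟨ n≤1+n _ ⟩
        suc (length onlyRed + length blueHeavy) ∎)
      where
      open ≤-Reasoning
      lemma : ∀ a b → a + (a + b) ≡ b + 2 * a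
      lemma = solve-∀
    ... | inj₁ p = copy-at-heavy n k red (All.map red-heavy light) (greedy-clique red n (suc k)
            (All.map (λ {x} ¬h → ≤-trans (length-filter-filter (¬? ∘ E? red x) (¬? ∘ heavy? n blue) (allFin N)) (≮⇒≥ ¬h))
              light) p)
      where
      light : All (¬_ ∘ Heavy n blue) onlyRed
      light = All.all-filter (¬? ∘ heavy? n blue) (allFin N)
      red-heavy : ∀ {x} → ¬ Heavy n blue x → Heavy n red x
      red-heavy {x} ¬h = Sum.[ id , ⊥-elim ∘ ¬h ]′ (heavy-cover n x (≤-trans (m≤n+m _ _) le))
    ... | inj₂ p with +-≤-split {a = suc k * suc n} {M} (≤-trans p (begin
        length blueHeavy                        ≤⟨ length-filter-split (heavy? n red) blueHeavy ⟩
        length bothHeavy + length onlyBlue      ≡⟨ +-comm (length bothHeavy) (length onlyBlue) ⟩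
        length onlyBlue + length bothHeavy      ≤⟨ n≤1+n _ ⟩
        suc (length onlyBlue + length bothHeavy) ∎))
      where open ≤-Reasoning
    ...   | inj₁ q = copy-at-heavy n k blue
            (All.filter⁺ (¬? ∘ heavy? n red) (All.all-filter (heavy? n blue) (allFin N)))
            (greedy-clique blue n (suc k) (All.map sparse (All.all-filter (¬? ∘ heavy? n red) blueHeavy)) q)
      where
      sparse : ∀ {x} → ¬ Heavy n red x → length (filter (¬? ∘ E? blue x) onlyBlue) ≤ n
      sparse {x} ¬h =
        ≤-trans (length-filter-filter (¬? ∘ E? blue x) (¬? ∘ heavy? n red) blueHeavy)
          (≤-trans (length-filter-filter (¬? ∘ E? blue x) (heavy? n blue) (allFin N)) (≮⇒≥ ¬h))
    ...   | inj₂ q with mono-clique χ arr (AllPairs.filter⁺ (heavy? n red)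
                          (AllPairs.filter⁺ (heavy? n blue) (Unique.allFin⁺ N))) q
    ...     | zero     , r = copy-at-heavy n k red (All.all-filter (heavy? n red) blueHeavy) r
    ...     | suc zero , r = copy-at-heavy n k blue
              (All.filter⁺ (heavy? n red) (All.all-filter (heavy? n blue) (allFin N))) r

R-kite-upper : ∀ n k → R (kite n (suc k)) ≤ R (complete (suc k)) + 2 * (suc k * suc n) + suc (n + n)
R-kite-upper n k = R-least (kite n (suc k)) λ χ → mono-kite χ n k _ (R-arrows (complete (suc k))) ≤-refl

R-kite-complete : ∀ n k → k ≤ suc n → R (complete k) ≤ R (kite n k)
R-kite-complete n k k≤ = R-least (complete k) (arrows-complete n k k≤ (R-arrows (kite n k)))

R-kite-chvátal : ∀ n j → j ≤ n → j * n < R (kite n (suc j))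
R-kite-chvátal n j j≤n = ≰⇒> λ le →
  ¬arrows-kite j n j≤n (arrows-mono (kite n (suc j)) le (R-arrows (kite n (suc j))))

-- Interpolation by kites

module _ (K : ℕ) (growth : ∀ k → R (complete (suc (suc k))) ≤ K * R (complete (suc k))) where

  -- Take the least j for which one of the two lower bounds for the kite with clique size j + 1
  -- reaches f; j = n qualifies. At j - 1 both fall short of f, so `growth` bounds the clique term
  -- by K f, and the remaining terms of `R-kite-upper` come to at most 10 f.
  kite-interpolates : ∀ n f → suc n ≤ f → f ≤ R (complete (suc n)) →
                      ∃[ k ] f ≤ R (kite n k) × R (kite n k) ≤ (K + 10) * f
  kite-interpolates n f n<f f≤R with least reaches? n (inj₁ f≤R)
    where
    reaches? : Decidable (λ j → f ≤ R (complete (suc j)) ⊎ f ≤ suc (j * n))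
    reaches? j = (f ≤? R (complete (suc j))) ⊎-dec (f ≤? suc (j * n))
  ... | j , reaches , minimal = suc j , lower reaches , upper j minimal
    where
    open ≤-Reasoning
    j≤n : j ≤ n
    j≤n = minimal n (inj₁ f≤R)

    lower : f ≤ R (complete (suc j)) ⊎ f ≤ suc (j * n) → f ≤ R (kite n (suc j))
    lower (inj₁ p) = ≤-trans p (R-kite-complete n (suc j) (s≤s j≤n))
    lower (inj₂ p) = ≤-trans p (R-kite-chvátal n j j≤n)

    upper : ∀ j → (∀ i → f ≤ R (complete (suc i)) ⊎ f ≤ suc (i * n) → j ≤ i) → R (kite n (suc j)) ≤ (K + 10) * f
    upper zero _ = begin
      R (kite n 1)                                     ≤⟨ R-kite-upper n 0 ⟩
      R (complete 1) + 2 * (1 * suc n) + suc (n + n)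
        -- There is no smaller clique to compare with here; Ramsey's theorem gives R(K_1) ≤ 2^(1 +
        -- 1) = 4.
        ≤⟨ +-monoˡ-≤ _ (+-monoˡ-≤ _ (R-least (complete 1) (arrows (complete 1)))) ⟩
      4 + 2 * (1 * suc n) + suc (n + n)                ≤⟨ m≤m+n _ (6 * n + 3) ⟩
      4 + 2 * (1 * suc n) + suc (n + n) + (6 * n + 3)  ≡⟨ lemma n ⟩
      10 * suc n                                       ≤⟨ *-mono-≤ (m≤n+m 10 K) n<f ⟩
      (K + 10) * f                                     ∎
      where
      lemma : ∀ n → 4 + 2 * (1 * suc n) + suc (n + n) + (6 * n + 3) ≡ 10 * suc n
      lemma = solve-∀
    upper (suc i) minimal = begin
      R (kite n (suc (suc i)))                                   ≤⟨ R-kite-upper n (suc i) ⟩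
      R (complete (suc (suc i))) + 2 * (suc (suc i) * suc n) + suc (n + n)
        ≤⟨ +-monoˡ-≤ _ (+-monoˡ-≤ _ (≤-trans (growth i) (*-monoʳ-≤ K small₁))) ⟩
      K * f + 2 * (suc (suc i) * suc n) + suc (n + n)            ≡⟨ lemma (K * f) i n ⟩
      K * f + (2 * (i * n) + 2 * i + 6 * n + 5)
        ≤⟨ +-monoʳ-≤ (K * f) (m≤m+n _ 1) ⟩
      K * f + (2 * (i * n) + 2 * i + 6 * n + 5 + 1)             ≡⟨ cong (K * f +_) (lemma′ i n) ⟩
      K * f + (2 * (i * n) + 2 * i + 6 * suc n)
        ≤⟨ +-monoʳ-≤ (K * f) (+-mono-≤ (+-mono-≤ (*-monoʳ-≤ 2 small₂) (*-monoʳ-≤ 2 i≤f)) (*-monoʳ-≤ 6 n<f)) ⟩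
      K * f + (2 * f + 2 * f + 6 * f)                            ≡⟨ lemma″ K f ⟩
      (K + 10) * f                                               ∎
      where
      small₁ : R (complete (suc i)) ≤ f
      small₁ = ≰⇒≥ λ le → 1+n≰n (minimal i (inj₁ le))
      small₂ : i * n ≤ f
      small₂ = ≤-trans (n≤1+n _) (≰⇒≥ λ le → 1+n≰n (minimal i (inj₂ le)))
      i≤f : i ≤ f
      i≤f = ≤-trans (n≤1+n i) (≤-trans (minimal n (inj₁ f≤R)) (≤-trans (n≤1+n n) n<f))
      lemma : ∀ a i n → a + 2 * (suc (suc i) * suc n) + suc (n + n) ≡ a + (2 * (i * n) + 2 * i + 6 * n + 5)
      lemma = solve-∀
      lemma′ : ∀ i n → 2 * (i * n) + 2 * i + 6 * n + 5 + 1 ≡ 2 * (i * n) + 2 * i + 6 * suc n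
      lemma′ = solve-∀
      lemma″ : ∀ K f → K * f + (2 * f + 2 * f + 6 * f) ≡ (K + 10) * f
      lemma″ = solve-∀

  interpolation : (f : ℕ → ℕ) → (∀ n → n ≤ f n × f n ≤ R (complete n)) →
                  Σ[ G ∈ (ℕ → Graph) ] (∀ n → Connected (G n)) ×
                    (∀ n → 1 ≤ n → order (G n) ≡ n × f n ≤ R (G n) × R (G n) ≤ (K + 10) * f n)
  interpolation f bounds = G , connected , good
    where
    size : ∀ n → ∃[ k ] f (suc n) ≤ R (kite n k) × R (kite n k) ≤ (K + 10) * f (suc n)
    size n = kite-interpolates n (f (suc n)) (proj₁ (bounds (suc n))) (proj₂ (bounds (suc n)))

    G : ℕ → Graph
    -- At index 0 no order is prescribed, but `Connected` demands a vertex; this kite is a single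
    -- vertex.
    G zero    = kite 0 0
    G (suc n) = kite n (proj₁ (size n))

    connected : ∀ n → Connected (G n)
    connected zero    = kite-connected 0 0
    connected (suc n) = kite-connected n (proj₁ (size n))

    good : ∀ n → 1 ≤ n → order (G n) ≡ n × f n ≤ R (G n) × R (G n) ≤ (K + 10) * f n
    good (suc n) _ = refl , proj₂ (size n)

theorem1p1 : ∃[ C ] ∃[ n₀ ] 0 < C × 0 < n₀ ×
    ((f : ℕ → ℕ) → f Preserves _≤_ ⟶ _≤_ →
    (∀ n → n ≤ f n × f n ≤ R (complete n)) →
    Σ[ G ∈ (ℕ → Graph) ] (∀ n → Connected (G n)) ×
    (∀ n → n₀ ≤ n → order (G n) ≡ n × f n ≤ R (G n) × R (G n) ≤ C * f n))
theorem1p1 = K + 10 , 1 , ≤-trans (s≤s z≤n) (m≤n+m 10 K) , s≤s z≤n ,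
             λ f _ → interpolation K (R-suc 15 ≤-refl) f
  where
  -- The 15 is the constant term of the exponent estimated in `ball-product`.
  K = 131 * (2 ^ 15 * 4)
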